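{- For all natural numbers $s$ and $q$ there is a number $X=X(s,q)$ such that every graph of treewidth at least $X$ contains either a canonical graph of order at least $s$ as an induced subgraph or the biclique $K_{q,q}$ as a (not necessarily induced) subgraph.
   Context: All graphs are finite, simple, undirected. For $i\ge 1$, $H_i$ is the graph obtained from a path $u_0\cdots u_i$ by attaching two pendant vertices to $u_0$ and two to $u_i$; $H'_i$ is obtained from $H_i$ by joining the two pendant vertices at one end, and $H''_i$ by joining both such pairs. An $H$-graph is any $H_i$, $H'_i$ or $H''_i$, with body the path $u_0\cdots u_i$. A hole is a chordless cycle of length at least four. A canonical graph is a hole or an $H$-graph; its order is its number of vertices for a hole, and the number of vertices of its body for an $H$-graph. -}

module Defs where

open import Data.Nat using (ℕ; zero; suc; _+_; _≤_; _<_; _≡ᵇ_; _≤ᵇ_)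
open import Data.Bool using (Bool; true; false; _∧_; _∨_)
open import Data.Fin using (Fin; toℕ; inject₁; fromℕ) renaming (zero to fzero; suc to fsuc)
open import Data.Fin.Subset using (Subset; _∈_; ∣_∣)
open import Data.Product using (Σ; ∃; ∃-syntax; _×_; _,_)
open import Data.Sum using (_⊎_)
open import Data.Unit using (⊤)
open import Relation.Binary.PropositionalEquality using (_≡_; _≢_)
open import Function.Definitions using (Injective)

record Graph : Set where
  field
    n      : ℕ
    adj    : Fin n → Fin n → Bool
    sym    : ∀ u v → adj u v ≡ adj v u
    irrefl : ∀ v → adj v v ≡ false
open Graph public

data WalkIn (G : Graph) (P : Fin (n G) → Set) : Fin (n G) → Fin (n G) → Set where
  here : ∀ {a} → P a → WalkIn G P a a
  step : ∀ {a b c} → P a → adj G a b ≡ true → WalkIn G P b c → WalkIn G P a c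

Connected : Graph → Set
Connected G = ∀ a b → WalkIn G (λ _ → ⊤) a b

record Cycle (G : Graph) : Set where
  field
    k     : ℕ
    c     : Fin (suc (suc (suc k))) → Fin (n G)
    inj   : Injective _≡_ _≡_ c
    edges : ∀ (i : Fin (suc (suc k))) → adj G (c (inject₁ i)) (c (fsuc i)) ≡ true
    close : adj G (c (fromℕ (suc (suc k)))) (c fzero) ≡ true

Acyclic : Graph → Set
Acyclic G = Cycle G → Data.Empty.⊥
  where import Data.Empty

record IsTree (T : Graph) : Set where
  field
    nonempty  : 0 < n T
    connected : Connected T
    acyclic   : Acyclic T

record TreeDecomposition (G : Graph) : Set where
  field
    tree      : Graph
    isTree    : IsTree tree
    bag       : Fin (n tree) → Subset (n G)
    coverV    : ∀ v → ∃[ t ] (v ∈ bag t)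
    coverE    : ∀ u v → adj G u v ≡ true → ∃[ t ] (u ∈ bag t × v ∈ bag t)
    subtree   : ∀ v t t' → v ∈ bag t → v ∈ bag t' →
                WalkIn tree (λ x → v ∈ bag x) t t'
open TreeDecomposition public

-- treewidth(G) ≥ X  iff every tree decomposition has width ≥ X,
-- i.e. has a bag with at least X + 1 vertices.
TreewidthAtLeast : ℕ → Graph → Set
TreewidthAtLeast X G = ∀ (D : TreeDecomposition G) → ∃[ t ] (suc X ≤ ∣ bag D t ∣)

holeAdjℕ : ℕ → ℕ → ℕ → Bool
holeAdjℕ k a b =
  (suc a ≡ᵇ b) ∨ (suc b ≡ᵇ a) ∨ ((a ≡ᵇ 0) ∧ (suc b ≡ᵇ k)) ∨ ((b ≡ᵇ 0) ∧ (suc a ≡ᵇ k))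

holeAdj : (k : ℕ) → Fin k → Fin k → Bool
holeAdj k a b = holeAdjℕ k (toℕ a) (toℕ b)

-- H-graph with body u_0 ... u_i as vertices 0 .. i, pendants i+1, i+2
-- at u_0 and i+3, i+4 at u_i; j₁ / j₂ say whether the pendant pair at
-- u_0 / u_i is joined.
hAdjℕ : ℕ → Bool → Bool → ℕ → ℕ → Bool
hAdjℕ i j₁ j₂ a b =
     ((suc a ≡ᵇ b) ∧ (b ≤ᵇ i)) ∨ ((suc b ≡ᵇ a) ∧ (a ≤ᵇ i))
  ∨ ((a ≡ᵇ 0) ∧ ((b ≡ᵇ i + 1) ∨ (b ≡ᵇ i + 2)))
  ∨ ((b ≡ᵇ 0) ∧ ((a ≡ᵇ i + 1) ∨ (a ≡ᵇ i + 2)))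
  ∨ ((a ≡ᵇ i) ∧ ((b ≡ᵇ i + 3) ∨ (b ≡ᵇ i + 4)))
  ∨ ((b ≡ᵇ i) ∧ ((a ≡ᵇ i + 3) ∨ (a ≡ᵇ i + 4)))
  ∨ (j₁ ∧ (((a ≡ᵇ i + 1) ∧ (b ≡ᵇ i + 2)) ∨ ((a ≡ᵇ i + 2) ∧ (b ≡ᵇ i + 1))))
  ∨ (j₂ ∧ (((a ≡ᵇ i + 3) ∧ (b ≡ᵇ i + 4)) ∨ ((a ≡ᵇ i + 4) ∧ (b ≡ᵇ i + 3))))

hAdj : (i : ℕ) → Bool → Bool → Fin (i + 5) → Fin (i + 5) → Bool
hAdj i j₁ j₂ a b = hAdjℕ i j₁ j₂ (toℕ a) (toℕ b)

InducedCopy : {m : ℕ} → (Fin m → Fin m → Bool) → Graph → Set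
InducedCopy {m} H G =
  Σ (Fin m → Fin (n G)) λ f → Injective _≡_ _≡_ f × (∀ a b → H a b ≡ adj G (f a) (f b))

ContainsCanonical : ℕ → Graph → Set
ContainsCanonical s G =
    (∃[ k ] (4 ≤ k × s ≤ k × InducedCopy (holeAdj k) G))
  ⊎ (∃[ i ] Σ Bool λ j₁ → Σ Bool λ j₂ →
        (1 ≤ i × s ≤ suc i × InducedCopy (hAdj i j₁ j₂) G))

ContainsBiclique : ℕ → Graph → Set
ContainsBiclique q G =
  Σ (Fin q → Fin (n G)) λ a → Σ (Fin q → Fin (n G)) λ b →
    Injective _≡_ _≡_ a × Injective _≡_ _≡_ b ×
    (∀ i j → a i ≢ b j) × (∀ i j → adj G (a i) (b j) ≡ true)

{-# OPTIONS --safe #-}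
module Submission where

-- In a graph G without large canonical graphs, two vertices of an induced subgraph that no single
-- further vertex separates are at bounded distance in it: on a long geodesic, two outside vertices
-- with neighbours near opposite ends would give an H-graph, and a long stretch without outside
-- neighbours would close up to a hole through a path avoiding one of its vertices.
--
-- If every small set W has a small balanced separator, G has small treewidth. Otherwise fix a bad
-- W, so that deleting any small set Z leaves a component containing more than half of W (the big
-- component). Call a vertex attached if no k vertices separate it from the big component. If few
-- vertices are attached, delete them; the remaining vertices are cut off by sets of size k, and
-- iterating these cuts around a vertex gives nested layers, so that G contains inseparable
-- vertices at a large distance. If many vertices are attached, any two of them stay at bounded
-- distance after a small deletion, hence all pairs from a large set of hubs can be linked by short
-- paths meeting only in hubs. By Ramsey's theorem for quadruples, some sequence h 0, h 1, … of hubs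
-- either yields a biclique, between links of disjoint pairs, or has no edges between the links of
-- h i, h j and of h k, h l for i < j < k < l. In the latter case the links of h i to h (i + 1) and
-- to h (i + 2) span an induced subgraph that is too long for its connectivity.

open import Defs renaming (sym to adj-sym; irrefl to adj-irrefl; n to ord; here to stop; step to go)
open import Data.Bool using (Bool; true; false; _∧_; _∨_; T)
import Data.Bool.Properties as Bool
open import Data.Empty using (⊥; ⊥-elim)
open import Data.Fin using (Fin; toℕ; fromℕ; inject₁) renaming (zero to fzero; suc to fsuc)
import Data.Fin.Properties as Fin
open import Data.Fin.Subset using (Subset; ∣_∣; ⁅_⁆; _∪_) renaming (_∈_ to _∈ₛ_; ⊥ to ∅)
open import Data.Fin.Relation.Unary.Top using (view; ‵fromℕ; ‵inject₁)
import Data.Fin.Subset.Properties as Subset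
open import Data.List using (List; []; _∷_; _++_; length; filter; take; allFin; concatMap; applyUpTo; upTo; cartesianProduct)
import Data.List.Properties as List
open import Data.List.Membership.Propositional using (_∈_; _∉_)
import Data.List.Membership.DecPropositional as DecMembership
open import Data.List.Membership.Propositional.Properties using (∈-++⁺ˡ; ∈-++⁺ʳ; ∈-++⁻; ∈-filter⁺; ∈-filter⁻; ∈-allFin; ∈-concatMap⁺; ∈-applyUpTo⁺; ∈-upTo⁺; ∈-cartesianProduct⁺; ∈-cartesianProduct⁻)
open import Data.List.Relation.Binary.Sublist.Propositional using ([]; _∷_; _∷ʳ_; ⊆-refl; ⊆-trans; minimum) renaming (_⊆_ to _⊑_; lookup to ⊑-lookup)
open import Data.List.Relation.Binary.Sublist.Propositional.Properties using (All-resp-⊆; take-⊆)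
open import Data.List.Relation.Unary.All using (All; []; _∷_)
import Data.List.Relation.Unary.All as All
import Data.List.Relation.Unary.Any as Any
open Any using (here; there)
open import Data.List.Relation.Unary.AllPairs using ([]; _∷_)
open import Data.List.Relation.Unary.Unique.Propositional using (Unique)
import Data.List.Relation.Unary.Unique.Propositional.Properties as Unique
open import Data.Nat hiding (_≟_)
open import Data.Nat.Induction using (<-rec)
open import Data.Nat.Properties
open import Data.Nat.Tactic.RingSolver using (solve-∀)
open import Data.Product using (Σ; ∃; ∃-syntax; _×_; _,_; proj₁; proj₂)
open import Data.Product.Properties using (≡-dec)
open import Data.Sum using (_⊎_; inj₁; inj₂)
import Data.Sum as Sum
open import Data.Unit using (⊤; tt)
open import Data.Vec using (Vec; []; _∷_)
open import Function using (_∘_; id; case_of_)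
open import Function.Definitions using (Injective)
open import Relation.Binary.Definitions using (tri<; tri≈; tri>)
open import Relation.Binary.PropositionalEquality using (_≡_; _≢_; refl; sym; trans; cong; cong₂; subst; subst₂; module ≡-Reasoning)
open import Relation.Nullary using (¬_; Dec; yes; no; does)
open import Relation.Nullary.Decidable using (_×-dec_; _⊎-dec_; ¬?; map′; dec-true; decidable-stable)
open import Relation.Unary using (Decidable)

-- Walks and geodesics

≡-from-⇔ : ∀ {x y : Bool} → (x ≡ true → y ≡ true) → (y ≡ true → x ≡ true) → x ≡ y
≡-from-⇔ {true}  {true}  f g = refl
≡-from-⇔ {true}  {false} f g = sym (f refl)
≡-from-⇔ {false} {true}  f g = g refl
≡-from-⇔ {false} {false} f g = refl

module Walks (G : Graph) where

  V : Set
  V = Fin (ord G)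

  _~_ : V → V → Set
  u ~ v = adj G u v ≡ true

  _~?_ : ∀ u v → Dec (u ~ v)
  u ~? v = adj G u v Bool.≟ true

  ~-sym : ∀ {u v} → u ~ v → v ~ u
  ~-sym {u} {v} e = trans (adj-sym G v u) e

  ~-irrefl : ∀ {u v} → u ≡ v → ¬ u ~ v
  ~-irrefl {u} refl e with () ← trans (sym e) (adj-irrefl G u)

  -- The length is an index so that distances can be compared. `A` holds at both ends as well, so
  -- these are the walks of the subgraph induced by `A`.
  data Walk (A : V → Set) : ℕ → V → V → Set where
    nil  : ∀ {a} → A a → Walk A 0 a a
    cons : ∀ {k a b c} → A a → a ~ b → Walk A k b c → Walk A (suc k) a c

  source∈ : ∀ {A k a b} → Walk A k a b → A a
  source∈ (nil x)      = x
  source∈ (cons x _ _) = x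

  map-walk : ∀ {A B : V → Set} → (∀ {v} → A v → B v) → ∀ {k a b} → Walk A k a b → Walk B k a b
  map-walk f (nil x)      = nil (f x)
  map-walk f (cons x e w) = cons (f x) e (map-walk f w)

  infixr 5 _++ʷ_
  _++ʷ_ : ∀ {A k l a b c} → Walk A k a b → Walk A l b c → Walk A (k + l) a c
  nil _      ++ʷ w′ = w′
  cons x e w ++ʷ w′ = cons x e (w ++ʷ w′)

  snoc : ∀ {A k a b c} → Walk A k a b → b ~ c → A c → Walk A (suc k) a c
  snoc (nil x)      e y = cons x e (nil y)
  snoc (cons x f w) e y = cons x f (snoc w e y)

  reverse-walk : ∀ {A k a b} → Walk A k a b → Walk A k b a
  reverse-walk (nil x)      = nil x
  reverse-walk (cons x e w) = snoc (reverse-walk w) (~-sym e) x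

  walk? : ∀ {A} → Decidable A → ∀ k a b → Dec (Walk A k a b)
  walk? {A} A? zero a b with a Fin.≟ b
  ... | no a≢b = no λ { (nil _) → a≢b refl }
  ... | yes refl = map′ nil source∈ (A? a)
  walk? {A} A? (suc k) a b =
    map′ (λ { (x , c , e , w) → cons x e w }) (λ { (cons x e w) → x , _ , e , w })
         (A? a ×-dec Fin.any? λ c → (a ~? c) ×-dec walk? A? k c b)

  -- Total on `ℕ`: indices beyond the length return the last vertex, so that `vertex∈` needs no
  -- bound.
  vertex : ∀ {A k a b} → Walk A k a b → ℕ → V
  vertex {a = a} (nil _)      _       = a
  vertex {a = a} (cons _ _ _) zero    = a
  vertex         (cons _ _ w) (suc i) = vertex w i

  vertex-start : ∀ {A k a b} (w : Walk A k a b) → vertex w 0 ≡ a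
  vertex-start (nil _)      = refl
  vertex-start (cons _ _ _) = refl

  vertex-end : ∀ {A k a b} (w : Walk A k a b) → vertex w k ≡ b
  vertex-end (nil _)      = refl
  vertex-end (cons _ _ w) = vertex-end w

  vertex∈ : ∀ {A k a b} (w : Walk A k a b) i → A (vertex w i)
  vertex∈ (nil x)      _       = x
  vertex∈ (cons x _ _) zero    = x
  vertex∈ (cons _ _ w) (suc i) = vertex∈ w i

  vertex-adj : ∀ {A k a b} (w : Walk A k a b) {i} → i < k → vertex w i ~ vertex w (suc i)
  vertex-adj (cons {a = a} _ e w) {zero}  _       = subst (a ~_) (sym (vertex-start w)) e
  vertex-adj (cons _ _ w)         {suc i} (s≤s q) = vertex-adj w q

  subpath : ∀ {A} (p : ℕ → V) i d → (∀ j → i ≤ j → j ≤ i + d → A (p j)) →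
            (∀ {j} → j < i + d → p j ~ p (suc j)) → Walk A d (p i) (p (i + d))
  subpath {A} p i zero    p∈ p-adj =
    subst (Walk A 0 (p i) ∘ p) (sym (+-identityʳ i)) (nil (p∈ i ≤-refl (m≤m+n i 0)))
  subpath {A} p i (suc d) p∈ p-adj =
    subst (Walk A (suc d) (p i) ∘ p) (sym shift)
      (cons (p∈ i ≤-refl (m≤m+n i (suc d))) (p-adj (m<m+n i z<s))
        (subpath p (suc i) d (λ j i<j j≤ → p∈ j (<⇒≤ i<j) (subst (j ≤_) (sym shift) j≤))
                             (λ {j} j< → p-adj (subst (j <_) (sym shift) j<))))
    where
    shift : i + suc d ≡ suc i + d
    shift = +-suc i d

  segment : ∀ {A} {ℓ : ℕ} (p : ℕ → V) → (∀ i → A (p i)) → (∀ {i} → i < ℓ → p i ~ p (suc i)) →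
            ∀ i d → i + d ≤ ℓ → Walk A d (p i) (p (i + d))
  segment p p∈ p-adj i d le = subpath p i d (λ j _ _ → p∈ j) (λ j< → p-adj (≤-trans j< le))

  -- Distances are measured inside `A`. Equal vertices are joined by a walk of length 0 and adjacent
  -- ones by a walk of length 1, so `p-dist` makes the path injective and induced.
  record Geodesic (A : V → Set) (ℓ : ℕ) (a b : V) : Set where
    field
      p       : ℕ → V
      p-start : p 0 ≡ a
      p-end   : p ℓ ≡ b
      p∈      : ∀ i → A (p i)
      p-adj   : ∀ {i} → i < ℓ → p i ~ p (suc i)
      p-dist  : ∀ {i j d} → i ≤ j → j ≤ ℓ → Walk A d (p i) (p j) → j ≤ i + d

    p-inj : ∀ {i j} → i ≤ ℓ → j ≤ ℓ → p i ≡ p j → i ≡ j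
    p-inj {i} {j} i≤ j≤ eq = ≤-antisym (half j≤ i≤ (sym eq)) (half i≤ j≤ eq)
      where
      half : ∀ {i j} → i ≤ ℓ → j ≤ ℓ → p i ≡ p j → j ≤ i
      half {i} {j} i≤ j≤ eq with ≤-total i j
      ... | inj₂ j≤i = j≤i
      ... | inj₁ i≤j = subst (j ≤_) (+-identityʳ i) (p-dist i≤j j≤ (subst (Walk A 0 (p i)) eq (nil (p∈ i))))

    p-induced : ∀ {i j} → i < j → j ≤ ℓ → p i ~ p j → j ≡ suc i
    p-induced {i} {j} i<j j≤ e =
      ≤-antisym (subst (j ≤_) (+-comm i 1) (p-dist (<⇒≤ i<j) j≤ (cons (p∈ i) e (nil (p∈ j))))) i<j

  -- Descent to a walk that no shorter one replaces. A shortcut between two of its vertices, spliced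
  -- between prefix and suffix, would be such a replacement.
  shortest : ∀ {A} → Decidable A → ∀ {k a b} → Walk A k a b → ∃[ ℓ ] (Geodesic A ℓ a b × ℓ ≤ k)
  shortest {A} A? {k} {a} {b} = <-rec (λ k → Walk A k a b → ∃[ ℓ ] (Geodesic A ℓ a b × ℓ ≤ k)) rec k
    where
    rec : ∀ k → (∀ {m} → m < k → Walk A m a b → ∃[ ℓ ] (Geodesic A ℓ a b × ℓ ≤ m)) →
          Walk A k a b → ∃[ ℓ ] (Geodesic A ℓ a b × ℓ ≤ k)
    rec k ih w with anyUpTo? (λ m → walk? A? m a b) k
    ... | yes (m , m<k , w′) with ℓ , g , ℓ≤m ← ih m<k w′ = ℓ , g , ≤-trans ℓ≤m (<⇒≤ m<k)
    ... | no minimal = k , geo , ≤-refl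
      where
      geo : Geodesic A k a b
      geo = record
        { p = vertex w ; p-start = vertex-start w ; p-end = vertex-end w
        ; p∈ = vertex∈ w ; p-adj = vertex-adj w ; p-dist = dist }
        where
        dist : ∀ {i j d} → i ≤ j → j ≤ k → Walk A d (vertex w i) (vertex w j) → j ≤ i + d
        dist {i} {j} {d} i≤j j≤k u = +-cancelʳ-≤ (k ∸ j) j (i + d) (subst₂ _≤_ (sym j+r) (sym (+-assoc i d (k ∸ j))) le)
          where
          seg = segment {A} {k} (vertex w) (vertex∈ w) (vertex-adj w)
          j+r : j + (k ∸ j) ≡ k
          j+r = m+[n∸m]≡n j≤k
          prefix : Walk A i a (vertex w i)
          prefix = subst (λ x → Walk A i x (vertex w i)) (vertex-start w) (seg 0 i (≤-trans i≤j j≤k))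
          suffix : Walk A (k ∸ j) (vertex w j) b
          suffix = subst (Walk A (k ∸ j) (vertex w j)) (trans (cong (vertex w) j+r) (vertex-end w))
                     (seg j (k ∸ j) (≤-reflexive j+r))
          le : k ≤ i + (d + (k ∸ j))
          le = ≮⇒≥ λ lt → minimal (_ , lt , prefix ++ʷ (u ++ʷ suffix))

  Reach : (V → Set) → V → V → Set
  Reach A a b = ∃[ k ] Walk A k a b

  abstract
    -- A geodesic is injective, hence has fewer than `ord G` edges, so a bounded search suffices.
    reach? : ∀ {A} → Decidable A → ∀ a b → Dec (Reach A a b)
    reach? {A} A? a b = map′ (λ { (k , _ , w) → k , w }) bound (anyUpTo? (λ k → walk? A? k a b) (ord G))
      where
      bound : Reach A a b → ∃[ k ] (k < ord G × Walk A k a b)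
      bound (k , w) with ℓ , g , _ ← shortest A? w = ℓ , ℓ<n , w′
        where
        open Geodesic g
        f : Fin (suc ℓ) → V
        f i = p (toℕ i)
        toℕ≤ : ∀ (i : Fin (suc ℓ)) → toℕ i ≤ ℓ
        toℕ≤ i = s≤s⁻¹ (Fin.toℕ<n i)
        ℓ<n : ℓ < ord G
        ℓ<n = Fin.injective⇒≤ {f = f} λ {i} {j} eq → Fin.toℕ-injective (p-inj (toℕ≤ i) (toℕ≤ j) eq)
        w′ : Walk A ℓ a b
        w′ = subst₂ (Walk A ℓ) p-start p-end (segment {ℓ = ℓ} p p∈ p-adj 0 ℓ ≤-refl)

  reach-refl : ∀ {A a} → A a → Reach A a a
  reach-refl x = 0 , nil x

  reach-edge : ∀ {A a b} → A a → A b → a ~ b → Reach A a b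
  reach-edge x y e = 1 , cons x e (nil y)

  reach-trans : ∀ {A a b c} → Reach A a b → Reach A b c → Reach A a c
  reach-trans (_ , w) (_ , w′) = _ , w ++ʷ w′

  reach-sym : ∀ {A a b} → Reach A a b → Reach A b a
  reach-sym (_ , w) = _ , reverse-walk w

  map-reach : ∀ {A B : V → Set} → (∀ {v} → A v → B v) → ∀ {a b} → Reach A a b → Reach B a b
  map-reach f (_ , w) = _ , map-walk f w

  target∈ : ∀ {A a b} → Reach A a b → A b
  target∈ r = source∈ (proj₂ (reach-sym r))

-- Canonical graphs as induced copies

∨⁻ : ∀ {x y} → x ∨ y ≡ true → x ≡ true ⊎ y ≡ true
∨⁻ {true}  _ = inj₁ refl
∨⁻ {false} e = inj₂ e

∨⁺ˡ : ∀ {x y} → x ≡ true → x ∨ y ≡ true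
∨⁺ˡ refl = refl

∨⁺ʳ : ∀ {x y} → y ≡ true → x ∨ y ≡ true
∨⁺ʳ {x} refl = Bool.∨-zeroʳ x

∧⁻ : ∀ {x y} → x ∧ y ≡ true → x ≡ true × y ≡ true
∧⁻ {true} e = refl , e

∧⁺ : ∀ {x y} → x ≡ true → y ≡ true → x ∧ y ≡ true
∧⁺ refl refl = refl

≡ᵇ⁻ : ∀ {a b} → (a ≡ᵇ b) ≡ true → a ≡ b
≡ᵇ⁻ {a} {b} e = ≡ᵇ⇒≡ a b (subst T (sym e) tt)

≡ᵇ⁺ : ∀ {a b} → a ≡ b → (a ≡ᵇ b) ≡ true
≡ᵇ⁺ {zero}  refl = refl
≡ᵇ⁺ {suc a} refl = ≡ᵇ⁺ {a} refl

≤ᵇ⁻ : ∀ {a b} → (a ≤ᵇ b) ≡ true → a ≤ b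
≤ᵇ⁻ {a} {b} e = ≤ᵇ⇒≤ a b (subst T (sym e) tt)

≤ᵇ⁺ : ∀ {a b} → a ≤ b → (a ≤ᵇ b) ≡ true
≤ᵇ⁺ z≤n             = refl
≤ᵇ⁺ (s≤s z≤n)       = refl
≤ᵇ⁺ (s≤s (s≤s a≤b)) = ≤ᵇ⁺ (s≤s a≤b)

module Copies (G : Graph) where
  open Walks G

  CycleEdge : ℕ → ℕ → ℕ → Set
  CycleEdge k i j = (j ≡ suc i) ⊎ (i ≡ 0 × suc j ≡ k)

  hole-copy : ∀ {s k} (c : ℕ → V) → 4 ≤ k → s ≤ k →
              (∀ {i j} → i < j → j < k → c i ≢ c j) →
              (∀ {i j} → i < j → j < k → CycleEdge k i j → c i ~ c j) →
              (∀ {i j} → i < j → j < k → c i ~ c j → CycleEdge k i j) →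
              ContainsCanonical s G
  hole-copy {s} {k} c 4≤k s≤k c-inj edge only = inj₁ (k , 4≤k , s≤k , f , f-inj , iff)
    where
    f : Fin k → V
    f i = c (toℕ i)
    f-inj : Injective _≡_ _≡_ f
    f-inj {i} {j} eq with <-cmp (toℕ i) (toℕ j)
    ... | tri< lt _ _ = ⊥-elim (c-inj lt (Fin.toℕ<n j) eq)
    ... | tri≈ _ e _  = Fin.toℕ-injective e
    ... | tri> _ _ gt = ⊥-elim (c-inj gt (Fin.toℕ<n i) (sym eq))
    Adj : ℕ → ℕ → Set
    Adj a b = (suc a ≡ b) ⊎ (suc b ≡ a) ⊎ (a ≡ 0 × suc b ≡ k) ⊎ (b ≡ 0 × suc a ≡ k)
    from : ∀ a b → holeAdjℕ k a b ≡ true → Adj a b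
    from a b e with ∨⁻ e
    ... | inj₁ e = inj₁ (≡ᵇ⁻ e)
    ... | inj₂ e with ∨⁻ e
    ... | inj₁ e = inj₂ (inj₁ (≡ᵇ⁻ e))
    ... | inj₂ e with ∨⁻ e
    ... | inj₁ e with p , q ← ∧⁻ e = inj₂ (inj₂ (inj₁ (≡ᵇ⁻ p , ≡ᵇ⁻ q)))
    ... | inj₂ e with p , q ← ∧⁻ e = inj₂ (inj₂ (inj₂ (≡ᵇ⁻ p , ≡ᵇ⁻ q)))
    to : ∀ a b → Adj a b → holeAdjℕ k a b ≡ true
    to a b (inj₁ e) = ∨⁺ˡ (≡ᵇ⁺ e)
    to a b (inj₂ (inj₁ e)) = ∨⁺ʳ {suc a ≡ᵇ b} (∨⁺ˡ (≡ᵇ⁺ e))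
    to a b (inj₂ (inj₂ (inj₁ (p , q)))) = ∨⁺ʳ {suc a ≡ᵇ b} (∨⁺ʳ {suc b ≡ᵇ a} (∨⁺ˡ (∧⁺ (≡ᵇ⁺ p) (≡ᵇ⁺ q))))
    to a b (inj₂ (inj₂ (inj₂ (p , q)))) =
      ∨⁺ʳ {suc a ≡ᵇ b} (∨⁺ʳ {suc b ≡ᵇ a} (∨⁺ʳ {(a ≡ᵇ 0) ∧ (suc b ≡ᵇ k)} (∧⁺ (≡ᵇ⁺ p) (≡ᵇ⁺ q))))
    ordered : ∀ {a b} → a < b → Adj a b → CycleEdge k a b
    ordered a<b (inj₁ e)                      = inj₁ (sym e)
    ordered a<b (inj₂ (inj₁ refl))            = ⊥-elim (<-asym a<b ≤-refl)
    ordered a<b (inj₂ (inj₂ (inj₁ pq)))       = inj₂ pq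
    ordered ()  (inj₂ (inj₂ (inj₂ (refl , _))))
    swap : ∀ {a b} → Adj a b → Adj b a
    swap (inj₁ e)               = inj₂ (inj₁ e)
    swap (inj₂ (inj₁ e))        = inj₁ e
    swap (inj₂ (inj₂ (inj₁ e))) = inj₂ (inj₂ (inj₂ e))
    swap (inj₂ (inj₂ (inj₂ e))) = inj₂ (inj₂ (inj₁ e))
    unordered : ∀ {a b} → CycleEdge k a b → Adj a b
    unordered (inj₁ e) = inj₁ (sym e)
    unordered (inj₂ e) = inj₂ (inj₂ (inj₁ e))
    loopless : ∀ {a} → ¬ Adj a a
    loopless (inj₁ e)        = 1+n≢n e
    loopless (inj₂ (inj₁ e)) = 1+n≢n e
    loopless (inj₂ (inj₂ (inj₁ (refl , refl)))) = case 4≤k of λ { (s≤s ()) }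
    loopless (inj₂ (inj₂ (inj₂ (refl , refl)))) = case 4≤k of λ { (s≤s ()) }
    iff : ∀ i j → holeAdj k i j ≡ adj G (f i) (f j)
    iff i j with <-cmp (toℕ i) (toℕ j)
    ... | tri< lt _ _ = ≡-from-⇔ (λ e → edge lt (Fin.toℕ<n j) (ordered lt (from (toℕ i) (toℕ j) e)))
                                  (λ e → to (toℕ i) (toℕ j) (unordered (only lt (Fin.toℕ<n j) e)))
    ... | tri≈ _ e _ = ≡-from-⇔ (λ h → ⊥-elim (loopless (subst (Adj (toℕ i)) (sym e) (from (toℕ i) (toℕ j) h))))
                                 (λ h → ⊥-elim (~-irrefl (cong c e) h))
    ... | tri> _ _ gt = ≡-from-⇔ (λ e → ~-sym (edge gt (Fin.toℕ<n i) (ordered gt (swap (from (toℕ i) (toℕ j) e)))))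
                                  (λ e → to (toℕ i) (toℕ j) (swap (unordered (only gt (Fin.toℕ<n i) (~-sym e)))))

  -- The body is r 1, …, r (1 + i); the pendant vertices are r 0 and t at one end, r (2 + i) and t′ at the other.
  module HGraph (i : ℕ) (1≤i : 1 ≤ i) (r : ℕ → V) (t t′ : V)
    (r-inj     : ∀ {a b} → a < b → b ≤ suc (suc i) → r a ≢ r b)
    (r-adj     : ∀ {a} → a ≤ suc i → r a ~ r (suc a))
    (r-induced : ∀ {a b} → a < b → b ≤ suc (suc i) → r a ~ r b → b ≡ suc a)
    (t-adj     : t ~ r 1)
    (t-only    : ∀ {a} → a ≤ suc (suc i) → t ~ r a → a ≤ 1)
    (t′-adj    : t′ ~ r (suc i))
    (t′-only   : ∀ {a} → a ≤ suc (suc i) → t′ ~ r a → suc i ≤ a)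
    (t∉r       : ∀ {a} → a ≤ suc (suc i) → t ≢ r a)
    (t′∉r      : ∀ {a} → a ≤ suc (suc i) → t′ ≢ r a)
    (t≢t′      : t ≢ t′)
    (t≁t′      : ¬ t ~ t′) where

    -- Whether a pendant pair is joined is read off from `G`, so one construction yields all three
    -- kinds of `H`-graph.
    j₁ j₂ : Bool
    j₁ = adj G (r 0) t
    j₂ = adj G (r (suc (suc i))) t′

    pendant : ℕ → V
    pendant 0 = r 0
    pendant 1 = t
    pendant 2 = r (suc (suc i))
    pendant _ = t′

    f : ℕ → V
    f a with a ≤? i
    ... | yes _ = r (suc a)
    ... | no  _ = pendant (a ∸ suc i)

    f-body : ∀ {a} → a ≤ i → f a ≡ r (suc a)
    f-body {a} a≤i with a ≤? i
    ... | yes _   = refl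
    ... | no  a≰i = ⊥-elim (a≰i a≤i)

    f-pendant : ∀ c → f (i + suc c) ≡ pendant c
    f-pendant c with i + suc c ≤? i
    ... | yes le = ⊥-elim (m+1+n≰m i le)
    ... | no  _  = cong pendant (trans (cong (_∸ suc i) (+-suc i c)) (m+n∸m≡n i c))

    data Position : ℕ → Set where
      body : ∀ {a} → a ≤ i → Position a
      pend : ∀ c → c < 4 → Position (i + suc c)

    position : ∀ {a} → a < i + 5 → Position a
    position {a} a< with a ≤? i
    ... | yes a≤i = body a≤i
    ... | no a≰i with c , refl ← m≤n⇒∃[o]m+o≡n (≰⇒> a≰i) =
      subst Position (+-suc i c) (pend c (s≤s⁻¹ (+-cancelˡ-< i (suc c) 5 (subst (_< i + 5) (sym (+-suc i c)) a<))))

    -- Every edge once, smaller index first. The relation mediates between the Boolean `hAdjℕ` and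
    -- adjacency in `G`, which then has to be analysed only for ordered pairs.
    data HEdge : ℕ → ℕ → Set where
      along  : ∀ {a} → suc a ≤ i → HEdge a (suc a)
      left₁  : HEdge 0 (i + 1)
      left₂  : HEdge 0 (i + 2)
      right₁ : HEdge i (i + 3)
      right₂ : HEdge i (i + 4)
      join₁  : j₁ ≡ true → HEdge (i + 1) (i + 2)
      join₂  : j₂ ≡ true → HEdge (i + 3) (i + 4)

    adjacent : ∀ {a b} → HEdge a b → f a ~ f b
    adjacent (along {a} le) = subst₂ _~_ (sym (f-body (≤-trans (n≤1+n a) le))) (sym (f-body le)) (r-adj (m≤n⇒m≤1+n le))
    adjacent left₁  = subst₂ _~_ (sym (f-body z≤n)) (sym (f-pendant 0)) (~-sym (r-adj z≤n))
    adjacent left₂  = subst₂ _~_ (sym (f-body z≤n)) (sym (f-pendant 1)) (~-sym t-adj)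
    adjacent right₁ = subst₂ _~_ (sym (f-body ≤-refl)) (sym (f-pendant 2)) (r-adj ≤-refl)
    adjacent right₂ = subst₂ _~_ (sym (f-body ≤-refl)) (sym (f-pendant 3)) (~-sym t′-adj)
    adjacent (join₁ e) = subst₂ _~_ (sym (f-pendant 0)) (sym (f-pendant 1)) e
    adjacent (join₂ e) = subst₂ _~_ (sym (f-pendant 2)) (sym (f-pendant 3)) e

    Distinguished : ℕ → ℕ → Set
    Distinguished a b = f a ≢ f b × (f a ~ f b → HEdge a b)

    via : ∀ {a b u v} → f a ≡ u → f b ≡ v → u ≢ v → (u ~ v → HEdge a b) → Distinguished a b
    via refl refl p q = p , q

    body-pend : ∀ {a} c → a ≤ i → c < 4 → Distinguished a (i + suc c)
    body-pend {a} 0 le _ = via (f-body le) (f-pendant 0) (λ e → r-inj z<s (s≤s (m≤n⇒m≤1+n le)) (sym e))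
      λ e → case r-induced z<s (s≤s (m≤n⇒m≤1+n le)) (~-sym e) of λ { refl → left₁ }
    body-pend {a} 1 le _ = via (f-body le) (f-pendant 1) (λ e → t∉r (s≤s (m≤n⇒m≤1+n le)) (sym e))
      λ e → case t-only (s≤s (m≤n⇒m≤1+n le)) (~-sym e) of λ { (s≤s z≤n) → left₂ }
    body-pend {a} 2 le _ = via (f-body le) (f-pendant 2) (r-inj (s≤s (s≤s le)) ≤-refl)
      λ e → case r-induced (s≤s (s≤s le)) ≤-refl e of λ { refl → right₁ }
    body-pend {a} 3 le _ = via (f-body le) (f-pendant 3) (λ e → t′∉r (s≤s (m≤n⇒m≤1+n le)) (sym e))
      λ e → case ≤-antisym le (s≤s⁻¹ (t′-only (s≤s (m≤n⇒m≤1+n le)) (~-sym e))) of λ { refl → right₂ }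
    body-pend (suc (suc (suc (suc _)))) _ (s≤s (s≤s (s≤s (s≤s ()))))

    pend-pend : ∀ c c′ → c < c′ → c′ < 4 → Distinguished (i + suc c) (i + suc c′)
    pend-pend 0 1 _ _ = via (f-pendant 0) (f-pendant 1) (λ e → t∉r z≤n (sym e)) join₁
    pend-pend 0 2 _ _ = via (f-pendant 0) (f-pendant 2) (r-inj z<s ≤-refl)
      λ e → case r-induced z<s ≤-refl e of λ ()
    pend-pend 0 3 _ _ = via (f-pendant 0) (f-pendant 3) (λ e → t′∉r z≤n (sym e))
      λ e → case t′-only z≤n (~-sym e) of λ ()
    pend-pend 1 2 _ _ = via (f-pendant 1) (f-pendant 2) (t∉r ≤-refl)
      λ e → case t-only ≤-refl e of λ { (s≤s ()) }
    pend-pend 1 3 _ _ = via (f-pendant 1) (f-pendant 3) t≢t′ λ e → ⊥-elim (t≁t′ e)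
    pend-pend 2 3 _ _ = via (f-pendant 2) (f-pendant 3) (λ e → t′∉r ≤-refl (sym e)) join₂
    pend-pend 1 1 (s≤s ()) _
    pend-pend 2 1 (s≤s ()) _
    pend-pend 2 2 (s≤s (s≤s ())) _
    pend-pend (suc (suc (suc _))) _ (s≤s (s≤s (s≤s (s≤s _)))) (s≤s (s≤s (s≤s (s≤s ()))))
    pend-pend _ (suc (suc (suc (suc _)))) _ (s≤s (s≤s (s≤s (s≤s ()))))

    distinguished : ∀ {a b} → a < b → b < i + 5 → Distinguished a b
    distinguished a<b b< with position (<-trans a<b b<) | position b<
    ... | body le | body le′ = via (f-body le) (f-body le′) (r-inj (s≤s a<b) (m≤n⇒m≤1+n (s≤s le′)))
      λ e → case suc-injective (r-induced (s≤s a<b) (m≤n⇒m≤1+n (s≤s le′)) e) of λ { refl → along le′ }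
    ... | body le | pend c c< = body-pend c le c<
    ... | pend c c< | body le = ⊥-elim (m+1+n≰m i (≤-trans (<⇒≤ a<b) le))
    ... | pend c c< | pend c′ c′< = pend-pend c c′ (s≤s⁻¹ (+-cancelˡ-< i (suc c) (suc c′) a<b)) c′<

    at : ∀ {a b x y} → (a ≡ᵇ x) ≡ true → (b ≡ᵇ y) ≡ true → HEdge x y → HEdge a b
    at p q = subst₂ HEdge (sym (≡ᵇ⁻ p)) (sym (≡ᵇ⁻ q))

    at-end : ∀ {a b x y z} → (a ≡ᵇ x) ∧ ((b ≡ᵇ y) ∨ (b ≡ᵇ z)) ≡ true → HEdge x y → HEdge x z → HEdge a b
    at-end e h h′ with p , q ← ∧⁻ e with ∨⁻ q
    ... | inj₁ q = at p q h
    ... | inj₂ q = at p q h′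

    at-join : ∀ {j : Bool} {a b x y} → j ∧ (((a ≡ᵇ x) ∧ (b ≡ᵇ y)) ∨ ((a ≡ᵇ y) ∧ (b ≡ᵇ x))) ≡ true →
              (j ≡ true → HEdge x y) → HEdge a b ⊎ HEdge b a
    at-join e h with j , q ← ∧⁻ e with ∨⁻ q
    ... | inj₁ q with p , q ← ∧⁻ q = inj₁ (at p q (h j))
    ... | inj₂ q with p , q ← ∧⁻ q = inj₂ (at q p (h j))

    along′ : ∀ {a b} → (suc a ≡ᵇ b) ∧ (b ≤ᵇ i) ≡ true → HEdge a b
    along′ {a} {b} e with p , q ← ∧⁻ {suc a ≡ᵇ b} e with refl ← ≡ᵇ⁻ {suc a} {b} p = along (≤ᵇ⁻ q)

    from : ∀ a b → hAdjℕ i j₁ j₂ a b ≡ true → HEdge a b ⊎ HEdge b a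
    from a b e with ∨⁻ {(suc a ≡ᵇ b) ∧ (b ≤ᵇ i)} e
    ... | inj₁ e = inj₁ (along′ e)
    ... | inj₂ e with ∨⁻ {(suc b ≡ᵇ a) ∧ (a ≤ᵇ i)} e
    ... | inj₁ e = inj₂ (along′ e)
    ... | inj₂ e with ∨⁻ e
    ... | inj₁ e = inj₁ (at-end e left₁ left₂)
    ... | inj₂ e with ∨⁻ e
    ... | inj₁ e = inj₂ (at-end e left₁ left₂)
    ... | inj₂ e with ∨⁻ e
    ... | inj₁ e = inj₁ (at-end e right₁ right₂)
    ... | inj₂ e with ∨⁻ e
    ... | inj₁ e = inj₂ (at-end e right₁ right₂)
    ... | inj₂ e with ∨⁻ e
    ... | inj₁ e = at-join e join₁
    ... | inj₂ e = at-join e join₂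

    module _ (a b : ℕ) where
      d₁ d₂ d₃ d₄ d₅ d₆ d₇ : Bool
      d₁ = (suc a ≡ᵇ b) ∧ (b ≤ᵇ i)
      d₂ = (suc b ≡ᵇ a) ∧ (a ≤ᵇ i)
      d₃ = (a ≡ᵇ 0) ∧ ((b ≡ᵇ i + 1) ∨ (b ≡ᵇ i + 2))
      d₄ = (b ≡ᵇ 0) ∧ ((a ≡ᵇ i + 1) ∨ (a ≡ᵇ i + 2))
      d₅ = (a ≡ᵇ i) ∧ ((b ≡ᵇ i + 3) ∨ (b ≡ᵇ i + 4))
      d₆ = (b ≡ᵇ i) ∧ ((a ≡ᵇ i + 3) ∨ (a ≡ᵇ i + 4))
      d₇ = j₁ ∧ (((a ≡ᵇ i + 1) ∧ (b ≡ᵇ i + 2)) ∨ ((a ≡ᵇ i + 2) ∧ (b ≡ᵇ i + 1)))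
      skip₂ : ∀ {z} → z ≡ true → d₁ ∨ d₂ ∨ z ≡ true
      skip₂ = ∨⁺ʳ {d₁} ∘ ∨⁺ʳ {d₂}
      skip₄ : ∀ {z} → z ≡ true → d₁ ∨ d₂ ∨ d₃ ∨ d₄ ∨ z ≡ true
      skip₄ = skip₂ ∘ ∨⁺ʳ {d₃} ∘ ∨⁺ʳ {d₄}
      skip₆ : ∀ {z} → z ≡ true → d₁ ∨ d₂ ∨ d₃ ∨ d₄ ∨ d₅ ∨ d₆ ∨ z ≡ true
      skip₆ = skip₄ ∘ ∨⁺ʳ {d₅} ∘ ∨⁺ʳ {d₆}

    to : ∀ {a b} → HEdge a b → hAdjℕ i j₁ j₂ a b ≡ true
    to (along {a} le) = ∨⁺ˡ (∧⁺ (≡ᵇ⁺ {suc a} refl) (≤ᵇ⁺ le))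
    to left₁  = skip₂ 0 (i + 1) (∨⁺ˡ (∧⁺ refl (∨⁺ˡ (≡ᵇ⁺ {i + 1} refl))))
    to left₂  = skip₂ 0 (i + 2) (∨⁺ˡ (∧⁺ refl (∨⁺ʳ {i + 2 ≡ᵇ i + 1} (≡ᵇ⁺ {i + 2} refl))))
    to right₁ = skip₄ i (i + 3) (∨⁺ˡ (∧⁺ (≡ᵇ⁺ {i} refl) (∨⁺ˡ (≡ᵇ⁺ {i + 3} refl))))
    to right₂ = skip₄ i (i + 4) (∨⁺ˡ (∧⁺ (≡ᵇ⁺ {i} refl) (∨⁺ʳ {i + 4 ≡ᵇ i + 3} (≡ᵇ⁺ {i + 4} refl))))
    to (join₁ e) = skip₆ (i + 1) (i + 2) (∨⁺ˡ (∧⁺ e (∨⁺ˡ (∧⁺ (≡ᵇ⁺ {i + 1} refl) (≡ᵇ⁺ {i + 2} refl)))))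
    to (join₂ e) = skip₆ (i + 3) (i + 4) (∨⁺ʳ {d₇ (i + 3) (i + 4)}
                     (∧⁺ e (∨⁺ˡ (∧⁺ (≡ᵇ⁺ {i + 3} refl) (≡ᵇ⁺ {i + 4} refl)))))

    hAdjℕ-sym : ∀ {a b} → HEdge b a → hAdjℕ i j₁ j₂ a b ≡ true
    hAdjℕ-sym (along {a} le) = ∨⁺ʳ {d₁ (suc a) a} (∨⁺ˡ (∧⁺ (≡ᵇ⁺ {suc a} refl) (≤ᵇ⁺ le)))
    hAdjℕ-sym left₁  = skip₂ (i + 1) 0 (∨⁺ʳ {d₃ (i + 1) 0} (∨⁺ˡ (∧⁺ refl (∨⁺ˡ (≡ᵇ⁺ {i + 1} refl)))))
    hAdjℕ-sym left₂  = skip₂ (i + 2) 0 (∨⁺ʳ {d₃ (i + 2) 0} (∨⁺ˡ (∧⁺ refl (∨⁺ʳ {i + 2 ≡ᵇ i + 1} (≡ᵇ⁺ {i + 2} refl)))))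
    hAdjℕ-sym right₁ = skip₄ (i + 3) i (∨⁺ʳ {d₅ (i + 3) i} (∨⁺ˡ (∧⁺ (≡ᵇ⁺ {i} refl) (∨⁺ˡ (≡ᵇ⁺ {i + 3} refl)))))
    hAdjℕ-sym right₂ = skip₄ (i + 4) i (∨⁺ʳ {d₅ (i + 4) i} (∨⁺ˡ (∧⁺ (≡ᵇ⁺ {i} refl) (∨⁺ʳ {i + 4 ≡ᵇ i + 3} (≡ᵇ⁺ {i + 4} refl)))))
    hAdjℕ-sym (join₁ e) = skip₆ (i + 2) (i + 1) (∨⁺ˡ (∧⁺ e (∨⁺ʳ {(i + 2 ≡ᵇ i + 1) ∧ (i + 1 ≡ᵇ i + 2)}
                            (∧⁺ (≡ᵇ⁺ {i + 2} refl) (≡ᵇ⁺ {i + 1} refl)))))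
    hAdjℕ-sym (join₂ e) = skip₆ (i + 4) (i + 3) (∨⁺ʳ {d₇ (i + 4) (i + 3)} (∧⁺ e (∨⁺ʳ {(i + 4 ≡ᵇ i + 3) ∧ (i + 3 ≡ᵇ i + 4)}
                            (∧⁺ (≡ᵇ⁺ {i + 4} refl) (≡ᵇ⁺ {i + 3} refl)))))

    copy : ∀ {s} → s ≤ suc i → ContainsCanonical s G
    copy s≤ = inj₂ (i , j₁ , j₂ , 1≤i , s≤ , g , g-inj , iff)
      where
      g : Fin (i + 5) → V
      g = f ∘ toℕ
      g-inj : Injective _≡_ _≡_ g
      g-inj {a} {b} eq with <-cmp (toℕ a) (toℕ b)
      ... | tri< lt _ _ = ⊥-elim (proj₁ (distinguished lt (Fin.toℕ<n b)) eq)
      ... | tri≈ _ e _  = Fin.toℕ-injective e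
      ... | tri> _ _ gt = ⊥-elim (proj₁ (distinguished gt (Fin.toℕ<n a)) (sym eq))
      iff : ∀ a b → hAdj i j₁ j₂ a b ≡ adj G (g a) (g b)
      iff a b = ≡-from-⇔ (λ e → Sum.[ adjacent , ~-sym ∘ adjacent ] (from (toℕ a) (toℕ b) e)) back
        where
        back : g a ~ g b → hAdj i j₁ j₂ a b ≡ true
        back e with <-cmp (toℕ a) (toℕ b)
        ... | tri< lt _ _ = to (proj₂ (distinguished lt (Fin.toℕ<n b)) e)
        ... | tri≈ _ eq _ = ⊥-elim (~-irrefl (cong f eq) e)
        ... | tri> _ _ gt = hAdjℕ-sym (proj₂ (distinguished gt (Fin.toℕ<n a)) (~-sym e))

-- Inseparable vertices are close

-- `d` counts the candidates above `j` still to be tried; the search goes down from `d + j`.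
greatest : ∀ {Q : ℕ → Set} → Decidable Q → ∀ d {j} → Q j → (∀ {a} → Q a → a ≤ d + j) →
           ∃[ m ] (Q m × j ≤ m × (∀ {a} → Q a → a ≤ m))
greatest Q? zero    qj bound = _ , qj , ≤-refl , bound
greatest {Q} Q? (suc d) {j} qj bound with Q? (suc d + j)
... | yes q = _ , q , m≤n+m j (suc d) , bound
... | no ¬q = greatest Q? d qj λ {a} qa → case m≤n⇒m<n∨m≡n (bound qa) of λ
  { (inj₁ lt)   → s≤s⁻¹ lt
  ; (inj₂ refl) → ⊥-elim (¬q qa) }

least : ∀ {Q : ℕ → Set} → Decidable Q → ∀ {j} → Q j → ∃[ m ] (Q m × m ≤ j × (∀ {a} → Q a → m ≤ a))
least {Q} Q? {j} = <-rec (λ j → Q j → ∃[ m ] (Q m × m ≤ j × (∀ {a} → Q a → m ≤ a))) rec j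
  where
  rec : ∀ j → (∀ {i} → i < j → Q i → ∃[ m ] (Q m × m ≤ i × (∀ {a} → Q a → m ≤ a))) →
        Q j → ∃[ m ] (Q m × m ≤ j × (∀ {a} → Q a → m ≤ a))
  rec j ih qj with anyUpTo? Q? j
  ... | yes (i , i<j , qi) with m , qm , m≤i , min ← ih i<j qi = m , qm , ≤-trans m≤i (<⇒≤ i<j) , min
  ... | no none = j , qj , ≤-refl , λ {a} qa → ≮⇒≥ λ a<j → none (a , a<j , qa)

-- A geodesic of this length has room for a stretch of 2 + s vertices near each end and, between
-- them, a body of length s + 4: the neighbours of a vertex on a geodesic span at most two edges.
path-bound : ℕ → ℕ
path-bound s = 2 + s + (2 + s + s + 8)

abstract
  -- Opaque, so that the large constants built on it do not unfold.
  diam : ℕ → ℕ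
  diam = path-bound

module Diameter (G : Graph) (s : ℕ) where
  open Walks G
  open Copies G

  _∖_ : (V → Set) → V → V → Set
  (A ∖ z) v = A v × v ≢ z

  -- The number of vertices of each stretch. At least `s` of them secure the order of the hole, and
  -- at least two its length four, since the closing path adds two or more.
  L : ℕ
  L = suc (suc s)

  module LongGeodesic {A : V → Set} (A? : Decidable A) {x y : V}
    (robust : ∀ z → z ≢ x → z ≢ y → Reach (A ∖ z) x y)
    {ℓ : ℕ} (g : Geodesic A ℓ x y) (bound<ℓ : path-bound s < ℓ) where
    open Geodesic g

    OffPath : V → Set
    OffPath t = A t × (∀ {i} → i < suc ℓ → t ≢ p i)

    Attached : ℕ → Set
    Attached j = ∃[ t ] (OffPath t × t ~ p j)

    attached? : Decidable Attached
    attached? j = Fin.any? λ t → (A? t ×-dec allUpTo? (λ i → ¬? (t Fin.≟ p i)) (suc ℓ)) ×-dec (t ~? p j)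

    -- The detour through `t` has length two, and a geodesic admits no shortcut.
    window : ∀ {t i j} → A t → j ≤ ℓ → t ~ p i → t ~ p j → j ≤ i + 2
    window {t} {i} {j} t∈ j≤ ti tj with ≤-total i j
    ... | inj₁ i≤j = p-dist i≤j j≤ (cons (p∈ i) (~-sym ti) (cons t∈ tj (nil (p∈ j))))
    ... | inj₂ j≤i = ≤-trans j≤i (m≤m+n i 2)

    Neighbour : V → ℕ → Set
    Neighbour t i = i ≤ ℓ × t ~ p i

    neighbour? : ∀ t → Decidable (Neighbour t)
    neighbour? t i = (i ≤? ℓ) ×-dec (t ~? p i)

    -- The body is `p (suc e)`, ..., `p (e + suc i)`, from the last neighbour of `t` to the first
    -- neighbour of `t′`; the path vertices just before and just after it are the other two
    -- pendants. If `t` and `t′` were equal or adjacent, at most three edges would join the ends of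
    -- the body, against `4 ≤ i`.
    end-pieces : ∀ {t t′ e i} → OffPath t → OffPath t′ → 4 ≤ i → s ≤ i → e + suc i < ℓ →
                 t ~ p (suc e) → (∀ {a} → Neighbour t a → a ≤ suc e) →
                 t′ ~ p (e + suc i) → (∀ {a} → Neighbour t′ a → e + suc i ≤ a) → ContainsCanonical s G
    end-pieces {t} {t′} {e} {i} (t∈ , t∉) (t′∈ , t′∉) 4≤i s≤i e+i<ℓ tp max t′p min =
      HGraph.copy i (≤-trans (s≤s z≤n) 4≤i) (λ a → p (e + a)) t t′
        (λ a<b b≤ eq → <⇒≢ (+-monoʳ-< e a<b) (p-inj (<⇒≤ (<-≤-trans (+-monoʳ-< e a<b) (end b≤))) (end b≤) eq))
        (λ {a} a≤ → subst (p (e + a) ~_) (cong p (sym (+-suc e a)))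
                      (p-adj (subst (_≤ ℓ) (+-suc e a) (end (s≤s a≤)))))
        (λ {a} {b} a<b b≤ ab → +-cancelˡ-≡ e b (suc a)
            (trans (p-induced (+-monoʳ-< e a<b) (end b≤) ab) (sym (+-suc e a))))
        (subst (λ c → t ~ p c) (+-comm 1 e) tp)
        (λ {a} a≤ ta → +-cancelˡ-≤ e a 1 (subst (e + a ≤_) (+-comm 1 e) (max (end a≤ , ta))))
        t′p
        (λ {a} a≤ ta → +-cancelˡ-≤ e (suc i) a (min (end a≤ , ta)))
        (λ a≤ → t∉ (s≤s (end a≤)))
        (λ a≤ → t′∉ (s≤s (end a≤)))
        (λ { refl → far (s≤s (s≤s z≤n)) (cons (p∈ _) (~-sym tp) (cons t∈ t′p (nil (p∈ _)))) })
        (λ tt′ → far ≤-refl (cons (p∈ _) (~-sym tp) (cons t∈ tt′ (cons t′∈ t′p (nil (p∈ _))))))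
        (m≤n⇒m≤1+n s≤i)
      where
      end : ∀ {a} → a ≤ suc (suc i) → e + a ≤ ℓ
      end {a} a≤ = ≤-trans (+-monoʳ-≤ e a≤) (subst (_≤ ℓ) (sym (+-suc e (suc i))) e+i<ℓ)
      far : ∀ {d} → d ≤ 3 → ¬ Walk A d (p (suc e)) (p (e + suc i))
      far {d} d≤3 w = <-irrefl refl (≤-trans 4≤i (≤-trans (+-cancelˡ-≤ (suc e) i d
        (subst (_≤ suc e + d) (+-suc e i)
          (p-dist (subst (suc e ≤_) (sym (+-suc e i)) (m≤m+n (suc e) i)) (<⇒≤ e+i<ℓ) w))) d≤3))

    -- By `window`, passing from the given neighbours to the last one of `t` and the first one of
    -- `t′` costs at most two at each end. The length bound leaves at least `s + 4` edges: `s` for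
    -- the order, four to keep `t` and `t′` apart.
    two-attachments : ∀ {t t′ j j′} → OffPath t → OffPath t′ → t ~ p (suc j) → t′ ~ p j′ →
                      suc j ≤ L → ℓ ≤ j′ + L → j′ < ℓ → ContainsCanonical s G
    two-attachments {t} {t′} {j} {j′} T@(t∈ , _) T′@(t′∈ , _) tj t′j′ j< ℓ≤ j′<
      with greatest (neighbour? t) (ℓ ∸ suc j) (suc-j≤ , tj)
             (λ { {a} (a≤ , _) → subst (a ≤_) (sym (m∸n+n≡m suc-j≤)) a≤ })
         | least (neighbour? t′) (<⇒≤ j′< , t′j′)
      where
      suc-j≤ : suc j ≤ ℓ
      suc-j≤ = ≤-trans j< (≤-trans (m≤m+n L (L + s + 8)) (<⇒≤ bound<ℓ))
    -- The last neighbour has index at least `suc j`, so a path vertex precedes it and can serve as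
    -- a pendant.
    ... | zero  , _             , () , _   | _
    ... | suc e , (m≤ , tm) , _  , max | m′ , (m′≤ , t′m′) , m′≤j′ , min = apart (m≤n⇒∃[o]m+o≡n gap)
      where
      open ≤-Reasoning
      regroup : ∀ l s → l + 2 + (s + 4) + 2 ≡ l + s + 8
      regroup = solve-∀
      gap : suc e + (s + 4) ≤ m′
      gap = +-cancelʳ-≤ 2 _ _ (begin
        suc e + (s + 4) + 2     ≤⟨ +-monoˡ-≤ 2 (+-monoˡ-≤ (s + 4) (window t∈ m≤ tj tm)) ⟩
        suc j + 2 + (s + 4) + 2 ≤⟨ +-monoˡ-≤ 2 (+-monoˡ-≤ (s + 4) (+-monoˡ-≤ 2 j<)) ⟩
        L + 2 + (s + 4) + 2     ≡⟨ regroup L s ⟩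
        L + s + 8               ≤⟨ +-cancelˡ-≤ L _ _ (begin
                                     L + (L + s + 8) ≤⟨ <⇒≤ bound<ℓ ⟩
                                     ℓ               ≤⟨ ℓ≤ ⟩
                                     j′ + L          ≡⟨ +-comm j′ L ⟩
                                     L + j′          ∎) ⟩
        j′                      ≤⟨ window t′∈ (<⇒≤ j′<) t′m′ t′j′ ⟩
        m′ + 2                  ∎)
      apart : ∃[ i ] suc e + (s + 4) + i ≡ m′ → ContainsCanonical s G
      apart (i , refl) = end-pieces T T′ (≤-trans (m≤n+m 4 s) (m≤m+n (s + 4) i)) (≤-trans (m≤m+n s 4) (m≤m+n (s + 4) i))
          (subst (_< ℓ) m′≡ (≤-<-trans m′≤j′ j′<)) tm max (subst (λ c → t′ ~ p c) m′≡ t′m′)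
          (λ {a} N → subst (_≤ a) m′≡ (min N))
        where
        m′≡ : suc e + (s + 4) + i ≡ e + suc (s + 4 + i)
        m′≡ = trans (+-assoc (suc e) (s + 4) i) (sym (+-suc e (s + 4 + i)))

    -- With `a = suc e`: since `p a` does not separate `x` from `y`, the path vertices on either
    -- side of the stretch are joined without `p a`, namely along the geodesic to `y`, over to `x`,
    -- and along the geodesic to `p e`. A shortest such connection Q closes the stretch to a hole.
    bare-segment : ∀ e → suc e + L ≤ ℓ → (∀ {i} → i < L → ¬ Attached (suc e + i)) → ContainsCanonical s G
    bare-segment e a+L≤ bare = glue (shortest B? (proj₂ around))
      where
      a : ℕ
      a = suc e
      B : V → Set
      B = A ∖ p a
      B? : Decidable B
      B? v = A? v ×-dec ¬? (v Fin.≟ p a)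
      a≤ℓ : a ≤ ℓ
      a≤ℓ = ≤-trans (m≤m+n a L) a+L≤
      a<a+L : a < a + L
      a<a+L = m<m+n a z<s
      off : ∀ {i} → i ≤ ℓ → i ≢ a → B (p i)
      off {i} i≤ i≢a = p∈ i , λ eq → i≢a (p-inj i≤ a≤ℓ eq)
      around : Reach B (p (a + L)) (p e)
      around = reach-trans (ℓ ∸ (a + L) , subst (Walk B _ _) (cong p up) (subpath p (a + L) (ℓ ∸ (a + L))
                   (λ i a+L≤i i≤ → off (subst (i ≤_) up i≤) (λ eq → <⇒≢ (<-≤-trans a<a+L a+L≤i) (sym eq)))
                   (λ {i} i< → p-adj (subst (i <_) up i<))))
                 (reach-trans (reach-sym (subst₂ (Reach B) (sym p-start) (sym p-end)
                     (robust (p a) (λ eq → case p-inj a≤ℓ z≤n (trans eq (sym p-start)) of λ ())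
                                   (λ eq → <⇒≢ (<-≤-trans a<a+L a+L≤) (p-inj a≤ℓ ≤-refl (trans eq (sym p-end)))))))
                   (e , subpath p 0 e (λ i _ i≤ → off (≤-trans i≤ (<⇒≤ a≤ℓ)) (<⇒≢ (s≤s i≤)))
                          (λ i< → p-adj (<-trans i< a≤ℓ))))
        where
        up : a + L + (ℓ ∸ (a + L)) ≡ ℓ
        up = m+[n∸m]≡n a+L≤

      inner≤ : ∀ {i} → i < L → a + i ≤ ℓ
      inner≤ i< = ≤-trans (+-monoʳ-≤ a (<⇒≤ i<)) a+L≤

      -- A neighbour off the geodesic would make the position attached; on the geodesic, `p-induced`
      -- leaves only the two adjacent positions.
      bare-nbr : ∀ {i v} → i < L → A v → v ~ p (a + i) → v ≡ p (e + i) ⊎ v ≡ p (suc a + i)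
      bare-nbr {i} {v} i< v∈ e′ with anyUpTo? (λ j → v Fin.≟ p j) (suc ℓ)
      ... | no v∉ = ⊥-elim (bare i< (v , (v∈ , λ j≤ eq → v∉ (_ , j≤ , eq)) , e′))
      ... | yes (j , s≤s j≤ , refl) with <-cmp j (a + i)
      ...   | tri< j<i _ _ = inj₁ (cong p (sym (suc-injective (p-induced j<i (inner≤ i<) e′))))
      ...   | tri≈ _ refl _ = ⊥-elim (~-irrefl refl e′)
      ...   | tri> _ _ i<j = inj₂ (cong p (p-induced i<j j≤ (~-sym e′)))

      glue : ∃[ m ] (Geodesic B m (p (a + L)) (p e) × m ≤ proj₁ around) → ContainsCanonical s G
      glue (m , geo , _) = hole-copy c 4≤k s≤k c-inj edge only
        where
        open Geodesic geo renaming (p to q; p-start to q-start; p-end to q-end; p∈ to q∈; p-adj to q-adj;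
                                    p-inj to q-inj; p-induced to q-induced) hiding (p-dist)

        -- Q meets the segment in no vertex: its neighbours on Q would be the two path neighbours,
        -- so Q would contain the preceding vertex as well, and in the end p a.
        avoids : ∀ {i j} → i < L → j ≤ m → q j ≢ p (a + i)
        avoids {zero} {j} i< j≤ eq = proj₂ (q∈ j) (trans eq (cong p (+-identityʳ a)))
        avoids {suc i} {zero} i< j≤ eq =
          <⇒≢ (+-monoʳ-< a i<) (p-inj (inner≤ i<) a+L≤ (trans (sym eq) q-start))
        avoids {suc i} {suc j} i< j≤ eq with m≤n⇒m<n∨m≡n j≤
        ... | inj₂ refl = <⇒≢ (m≤m+n a (suc i)) (p-inj (<⇒≤ a≤ℓ) (inner≤ i<) (trans (sym q-end) eq))
        ... | inj₁ j< with bare-nbr i< (proj₁ (q∈ j)) (subst (q j ~_) eq (q-adj j≤))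
                         | bare-nbr i< (proj₁ (q∈ (suc (suc j)))) (subst (q (suc (suc j)) ~_) eq (~-sym (q-adj j<)))
        ...   | inj₁ back | _ = avoids {i} {j} (<⇒≤ i<) (<⇒≤ j≤) (trans back (cong p (+-suc e i)))
        ...   | _ | inj₁ back = avoids {i} {suc (suc j)} (<⇒≤ i<) j< (trans back (cong p (+-suc e i)))
        ...   | inj₂ f | inj₂ f′ = <⇒≢ (<-trans (n<1+n j) (n<1+n (suc j))) (q-inj (<⇒≤ j≤) j< (trans f (sym f′)))

        k : ℕ
        k = L + suc m
        c : ℕ → V
        c i with i <? L
        ... | yes _ = p (a + i)
        ... | no  _ = q (i ∸ L)
        c-low : ∀ {i} → i < L → c i ≡ p (a + i)
        c-low {i} i< with i <? L
        ... | yes _  = refl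
        ... | no i≮L = ⊥-elim (i≮L i<)
        c-high : ∀ j → c (L + j) ≡ q j
        c-high j with L + j <? L
        ... | yes lt = ⊥-elim (m+n≮m L j lt)
        ... | no  _  = cong q (m+n∸m≡n L j)

        data Part : ℕ → Set where
          low  : ∀ {i} → i < L → Part i
          high : ∀ j → j ≤ m → Part (L + j)
        part : ∀ {i} → i < k → Part i
        part {i} i<k with i <? L
        ... | yes i<L = low i<L
        ... | no i≮L with j , refl ← m≤n⇒∃[o]m+o≡n (≮⇒≥ i≮L) = high j (s≤s⁻¹ (+-cancelˡ-< L j (suc m) i<k))

        -- By `bare-nbr` the vertex of Q is one of the two path neighbours of `p (a + i)`, and by
        -- `avoids` it is outside the stretch. So it is `p e` or `p (a + L)`, an end of Q, and the
        -- edge is one of the two junctions.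
        crossing : ∀ {i j} → i < L → j ≤ m → p (a + i) ~ q j → CycleEdge k i (L + j)
        crossing {i} {j} i< j≤ pq with bare-nbr i< (proj₁ (q∈ j)) (~-sym pq)
        crossing {zero} {j} i< j≤ pq | inj₁ eq = inj₂ (refl , trans (sym (+-suc L j)) (cong (λ h → L + suc h)
          (q-inj j≤ ≤-refl (trans eq (trans (cong p (+-identityʳ e)) (sym q-end))))))
        crossing {suc i} {j} i< j≤ pq | inj₁ eq = ⊥-elim (avoids {i} {j} (<⇒≤ i<) j≤ (trans eq (cong p (+-suc e i))))
        crossing {i} {j} i< j≤ pq | inj₂ eq with m≤n⇒m<n∨m≡n i<
        ... | inj₁ i+1< = ⊥-elim (avoids {suc i} {j} i+1< j≤ (trans eq (cong p (sym (+-suc a i)))))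
        ... | inj₂ refl = inj₁ (trans (cong (L +_) (q-inj j≤ z≤n (trans eq (trans (cong p (sym (+-suc a i))) (sym q-start)))))
                                      (+-identityʳ L))

        c-inj : ∀ {i j} → i < j → j < k → c i ≢ c j
        c-inj i<j j<k with part (<-trans i<j j<k) | part j<k
        ... | low i<L | low j<L = λ eq → <⇒≢ (+-monoʳ-< a i<j)
              (p-inj (inner≤ i<L) (inner≤ j<L) (trans (sym (c-low i<L)) (trans eq (c-low j<L))))
        ... | low i<L | high j j≤ = λ eq → avoids i<L j≤ (trans (sym (c-high j)) (trans (sym eq) (c-low i<L)))
        ... | high i i≤ | low j<L = ⊥-elim (m+n≮m L i (<-trans i<j j<L))
        ... | high i i≤ | high j j≤ = λ eq → <⇒≢ i<j
              (cong (L +_) (q-inj i≤ j≤ (trans (sym (c-high i)) (trans eq (c-high j)))))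

        only : ∀ {i j} → i < j → j < k → c i ~ c j → CycleEdge k i j
        only i<j j<k with part (<-trans i<j j<k) | part j<k
        ... | low i<L | low j<L = λ e′ → inj₁ (+-cancelˡ-≡ a _ _ (trans
              (p-induced (+-monoʳ-< a i<j) (inner≤ j<L) (subst₂ _~_ (c-low i<L) (c-low j<L) e′)) (sym (+-suc a _))))
        ... | low i<L | high j j≤ = λ e′ → crossing i<L j≤ (subst₂ _~_ (c-low i<L) (c-high j) e′)
        ... | high i i≤ | low j<L = ⊥-elim (m+n≮m L i (<-trans i<j j<L))
        ... | high i i≤ | high j j≤ = λ e′ → inj₁ (trans (cong (L +_)
              (q-induced (+-cancelˡ-< L i j i<j) j≤ (subst₂ _~_ (c-high i) (c-high j) e′))) (+-suc L i))

        edge : ∀ {i j} → i < j → j < k → CycleEdge k i j → c i ~ c j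
        edge {i} i<j j<k (inj₁ refl) with part (<-trans i<j j<k)
        ... | high i i≤ = subst₂ _~_ (sym (c-high i)) (sym (trans (cong c (sym (+-suc L i))) (c-high (suc i))))
              (q-adj (+-cancelˡ-≤ L _ _ (subst (_≤ L + m) (sym (+-suc L i)) (s≤s⁻¹ (subst (suc (L + i) <_) (+-suc L m) j<k)))))
        ... | low i<L with m≤n⇒m<n∨m≡n i<L
        ...   | inj₁ i+1< = subst₂ _~_ (sym (c-low i<L)) (sym (trans (c-low i+1<) (cong p (+-suc a i))))
              (p-adj (≤-trans (+-monoʳ-< a i<L) a+L≤))
        ...   | inj₂ refl = subst₂ _~_ (sym (c-low i<L))
              (sym (trans (cong c (sym (+-identityʳ L))) (trans (c-high 0) (trans q-start (cong p (+-suc a i))))))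
              (p-adj (subst (_≤ ℓ) (+-suc a i) a+L≤))
        edge {j = j} i<j j<k (inj₂ (refl , eq)) with refl ← suc-injective (trans eq (+-suc L m)) =
          subst₂ _~_ (sym (trans (c-low z<s) (cong p (+-identityʳ a)))) (sym (trans (c-high m) q-end))
            (~-sym (p-adj a≤ℓ))

        1≤m : 1 ≤ m
        1≤m = n≢0⇒n>0 λ { refl → <⇒≢ (<-trans (n<1+n e) a<a+L) (p-inj (<⇒≤ a≤ℓ) a+L≤ (trans (sym q-end) q-start)) }
        4≤k : 4 ≤ k
        4≤k = +-mono-≤ {2} {L} {2} {suc m} (s≤s (s≤s z≤n)) (s≤s 1≤m)
        s≤k : s ≤ k
        s≤k = ≤-trans (≤-trans (n≤1+n s) (n≤1+n (suc s))) (m≤m+n L (suc m))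

    conclusion : ContainsCanonical s G
    -- The first stretch starts at `p 1`, so that `p 0` remains as a vertex before it.
    conclusion with anyUpTo? (λ i → attached? (suc i)) L
    ... | no bare = bare-segment 0 1+L≤ (λ i< at → bare (_ , i< , at))
      where
      1+L≤ : suc L ≤ ℓ
      1+L≤ = ≤-trans (s≤s (m≤m+n L (L + s + 8))) bound<ℓ
    -- Here `ℓ` equals `suc e + L`, so the second stretch ends one vertex before the end of the
    -- geodesic.
    ... | yes (j , j< , t , T , tj) with e , eq ← m≤n⇒∃[o]m+o≡n {suc L} {ℓ} (≤-trans (s≤s (m≤m+n L (L + s + 8))) bound<ℓ)
                                    with anyUpTo? (λ i → attached? (suc e + i)) L
    ... | no bare = bare-segment e (≤-reflexive (trans (cong suc (+-comm e L)) eq)) (λ i< at → bare (_ , i< , at))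
    ... | yes (i , i< , t′ , T′ , t′i) = two-attachments T T′ tj t′i j<
            (≤-trans (≤-reflexive ℓ≡) (+-monoˡ-≤ L (m≤m+n (suc e) i)))
            (subst (suc e + i <_) (sym ℓ≡) (+-monoʳ-< (suc e) i<))
      where
      ℓ≡ : ℓ ≡ suc e + L
      ℓ≡ = trans (sym eq) (cong suc (+-comm L e))

  abstract
    diameter : ∀ {A} → Decidable A → ∀ {x y} → Reach A x y → (∀ z → z ≢ x → z ≢ y → Reach (A ∖ z) x y) →
               ContainsCanonical s G ⊎ ∃[ k ] (k ≤ diam s × Walk A k x y)
    diameter {A} A? (_ , w) robust with ℓ , g , _ ← shortest A? w with ℓ ≤? diam s
    ... | yes ℓ≤ = inj₂ (ℓ , ℓ≤ , subst₂ (Walk A ℓ) p-start p-end (segment p p∈ p-adj 0 ℓ ≤-refl))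
      where open Geodesic g
    ... | no  ℓ≰ = inj₁ (LongGeodesic.conclusion A? robust g (≰⇒> ℓ≰))

-- Tree decompositions from balanced separators

module TreeBuilding (G : Graph) where
  open Walks G
  open DecMembership (Fin._≟_ {ord G}) using (_∈?_)

  -- Trees grown by attaching leaves; the newest node is `fzero`. A new bag may share with the
  -- vertices covered so far only what lies in the bag of its parent, which is the local form of the
  -- condition that the nodes containing a vertex are connected. As it speaks of bags, the type is
  -- defined simultaneously with `bag-at`.
  data RootedTree : ℕ → Set
  bag-at : ∀ {m} → RootedTree m → Fin m → List V

  Covered : ∀ {m} → RootedTree m → V → Set
  Covered T v = ∃[ t ] v ∈ bag-at T t

  data RootedTree where
    root : RootedTree 1
    leaf : ∀ {m} (T : RootedTree m) (p : Fin m) (B : List V) →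
           (∀ {v} → v ∈ B → Covered T v → v ∈ bag-at T p) → RootedTree (suc m)

  bag-at root           _        = []
  bag-at (leaf T p B _) fzero    = B
  bag-at (leaf T p B _) (fsuc t) = bag-at T t

  abstract
    covered? : ∀ {m} (T : RootedTree m) → Decidable (Covered T)
    covered? T v = Fin.any? λ t → v ∈? bag-at T t

  does-true⁻ : ∀ {A : Set} (d : Dec A) → does d ≡ true → A
  does-true⁻ (yes a) _ = a

  edge : ∀ {m} → RootedTree m → Fin m → Fin m → Bool
  edge root           _        _        = false
  edge (leaf T p _ _) fzero    fzero    = false
  edge (leaf T p _ _) fzero    (fsuc j) = does (j Fin.≟ p)
  edge (leaf T p _ _) (fsuc i) fzero    = does (i Fin.≟ p)
  edge (leaf T p _ _) (fsuc i) (fsuc j) = edge T i j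

  edge-sym : ∀ {m} (T : RootedTree m) i j → edge T i j ≡ edge T j i
  edge-sym root           _        _        = refl
  edge-sym (leaf T p _ _) fzero    fzero    = refl
  edge-sym (leaf T p _ _) fzero    (fsuc j) = refl
  edge-sym (leaf T p _ _) (fsuc i) fzero    = refl
  edge-sym (leaf T p _ _) (fsuc i) (fsuc j) = edge-sym T i j

  edge-irrefl : ∀ {m} (T : RootedTree m) i → edge T i i ≡ false
  edge-irrefl root           _        = refl
  edge-irrefl (leaf T p _ _) fzero    = refl
  edge-irrefl (leaf T p _ _) (fsuc i) = edge-irrefl T i

  treeGraph : ∀ {m} → RootedTree m → Graph
  treeGraph {m} T = record { n = m ; adj = edge T ; sym = edge-sym T ; irrefl = edge-irrefl T }

  module _ {m} {T : RootedTree m} {p : Fin m} {B : List V} {ok : ∀ {v} → v ∈ B → Covered T v → v ∈ bag-at T p} where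

    T⁺ : RootedTree (suc m)
    T⁺ = leaf T p B ok

    leaf-edge : edge T⁺ (fsuc p) fzero ≡ true
    leaf-edge = dec-true (p Fin.≟ p) refl

    leaf-neighbour : ∀ {x} → edge T⁺ fzero x ≡ true → x ≡ fsuc p
    leaf-neighbour {fsuc j} e = cong fsuc (does-true⁻ (j Fin.≟ p) e)

    lift : ∀ {P : Fin (suc m) → Set} {a b} → WalkIn (treeGraph T) (P ∘ fsuc) a b →
           WalkIn (treeGraph T⁺) P (fsuc a) (fsuc b)
    lift (stop x)   = stop x
    lift (go x e w) = go x e (lift w)

    lift-snoc : ∀ {P : Fin (suc m) → Set} {a} → WalkIn (treeGraph T) (P ∘ fsuc) a p → P fzero →
                WalkIn (treeGraph T⁺) P (fsuc a) fzero
    lift-snoc (stop x)   y = go x leaf-edge (stop y)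
    lift-snoc (go x e w) y = go x e (lift-snoc w y)

    lift-cons : ∀ {P : Fin (suc m) → Set} {a} → P fzero → WalkIn (treeGraph T) (P ∘ fsuc) p a →
                WalkIn (treeGraph T⁺) P fzero (fsuc a)
    lift-cons x w = go x (trans (edge-sym T⁺ fzero (fsuc p)) leaf-edge) (lift w)

    -- Both cycle neighbours of the leaf would be its only tree neighbour `fsuc p`, against
    -- injectivity; `at-leaf` finds them according to whether the leaf comes last, first or in
    -- between. A cycle missing the leaf lies in the smaller tree.
    leaf-cycle : Acyclic (treeGraph T) → Acyclic (treeGraph T⁺)
    leaf-cycle acyclic record { k = k ; c = c ; inj = inj ; edges = edges ; close = close }
      with Fin.any? (λ i → c i Fin.≟ fzero)
    ... | yes (i , eq) = at-leaf i eq
      where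
      neighbour : ∀ i j → c i ≡ fzero → edge T⁺ (c i) (c j) ≡ true → c j ≡ fsuc p
      neighbour i j eq e = leaf-neighbour (subst (λ x → edge T⁺ x (c j) ≡ true) eq e)
      flip : ∀ i j → edge T⁺ (c i) (c j) ≡ true → edge T⁺ (c j) (c i) ≡ true
      flip i j e = trans (edge-sym T⁺ (c j) (c i)) e
      last = fromℕ (suc (suc k))
      at-leaf : ∀ i → c i ≡ fzero → ⊥
      at-leaf i eq with view i
      ... | ‵fromℕ = case inj (trans (neighbour last fzero eq close)
        (sym (neighbour last (inject₁ (fromℕ (suc k))) eq (flip (inject₁ (fromℕ (suc k))) last (edges (fromℕ (suc k))))))) of λ ()
      ... | ‵inject₁ fzero = case inj (trans (neighbour fzero (fsuc fzero) eq (edges fzero))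
        (sym (neighbour fzero last eq (flip last fzero close)))) of λ ()
      ... | ‵inject₁ (fsuc j) = <⇒≢ (<-trans (n<1+n (toℕ j)) (n<1+n (suc (toℕ j)))) (begin
        toℕ j                     ≡⟨ sym (trans (Fin.toℕ-inject₁ (inject₁ j)) (Fin.toℕ-inject₁ j)) ⟩
        toℕ (inject₁ (inject₁ j)) ≡⟨ cong toℕ (inj (trans
                                       (neighbour i′ (inject₁ (inject₁ j)) eq (flip (inject₁ (inject₁ j)) i′ (edges (inject₁ j))))
                                       (sym (neighbour i′ (fsuc (fsuc j)) eq (edges (fsuc j)))))) ⟩
        suc (suc (toℕ j))         ∎)
        where
        open ≡-Reasoning
        i′ = inject₁ (fsuc j)
    ... | no none = acyclic record
      { k = k ; c = c′ ; inj = λ {i} {j} eq → inj (trans (c≡ i) (trans (cong fsuc eq) (sym (c≡ j))))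
      ; edges = λ i → subst₂ (λ x y → edge T⁺ x y ≡ true) (c≡ (inject₁ i)) (c≡ (fsuc i)) (edges i)
      ; close = subst₂ (λ x y → edge T⁺ x y ≡ true) (c≡ (fromℕ (suc (suc k)))) (c≡ fzero) close }
      where
      below : ∀ x → x ≢ fzero → ∃[ y ] x ≡ fsuc y
      below fzero    ne = ⊥-elim (ne refl)
      below (fsuc y) _  = y , refl
      c′ : Fin (suc (suc (suc k))) → Fin m
      c′ i = proj₁ (below (c i) λ eq → none (i , eq))
      c≡ : ∀ i → c i ≡ fsuc (c′ i)
      c≡ i = proj₂ (below (c i) λ eq → none (i , eq))

  tree-nonempty : ∀ {m} → RootedTree m → 0 < m
  tree-nonempty root           = z<s
  tree-nonempty (leaf T _ _ _) = z<s

  tree-connected : ∀ {m} (T : RootedTree m) → Connected (treeGraph T)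
  tree-connected root           fzero    fzero    = stop tt
  tree-connected (leaf T p _ _) fzero    fzero    = stop tt
  tree-connected (leaf T p _ _) fzero    (fsuc j) = lift-cons tt (tree-connected T p j)
  tree-connected (leaf T p _ _) (fsuc i) fzero    = lift-snoc (tree-connected T i p) tt
  tree-connected (leaf T p _ _) (fsuc i) (fsuc j) = lift (tree-connected T i j)

  tree-acyclic : ∀ {m} (T : RootedTree m) → Acyclic (treeGraph T)
  tree-acyclic root           C with () ← Cycle.close C
  tree-acyclic (leaf T _ _ _) = leaf-cycle (tree-acyclic T)

  -- A vertex of the leaf bag that occurs in the old tree is in the bag of the parent, through which
  -- the walk enters or leaves the leaf.
  bag-walk : ∀ {m} (T : RootedTree m) {v} t t′ → v ∈ bag-at T t → v ∈ bag-at T t′ →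
             WalkIn (treeGraph T) (λ x → v ∈ bag-at T x) t t′
  bag-walk root            fzero    fzero    ()
  bag-walk (leaf T p _ ok) fzero    fzero    i  j = stop i
  bag-walk (leaf T p _ ok) fzero    (fsuc t) i  j = lift-cons i (bag-walk T p t (ok i (t , j)) j)
  bag-walk (leaf T p _ ok) (fsuc t) fzero    i  j = lift-snoc (bag-walk T t p i (ok j (t , i))) j
  bag-walk (leaf T p _ ok) (fsuc t) (fsuc u) i  j = lift (bag-walk T t u i j)

  toSubset : List V → Subset (ord G)
  toSubset []       = ∅
  toSubset (v ∷ vs) = ⁅ v ⁆ ∪ toSubset vs

  toSubset⁺ : ∀ {v vs} → v ∈ vs → v ∈ₛ toSubset vs
  toSubset⁺ (here refl) = Subset.x∈p∪q⁺ (inj₁ (Subset.x∈⁅x⁆ _))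
  toSubset⁺ (there i)   = Subset.x∈p∪q⁺ (inj₂ (toSubset⁺ i))

  toSubset⁻ : ∀ {v} vs → v ∈ₛ toSubset vs → v ∈ vs
  toSubset⁻ []       i = ⊥-elim (Subset.∉⊥ i)
  toSubset⁻ (x ∷ vs) i with Subset.x∈p∪q⁻ ⁅ x ⁆ (toSubset vs) i
  ... | inj₁ j = here (Subset.x∈⁅y⁆⇒x≡y x j)
  ... | inj₂ j = there (toSubset⁻ vs j)

  ∣⁅x⁆∪p∣≤1+∣p∣ : ∀ {n} (x : Fin n) (p : Subset n) → ∣ ⁅ x ⁆ ∪ p ∣ ≤ suc ∣ p ∣
  ∣⁅x⁆∪p∣≤1+∣p∣ fzero    (true  ∷ p) = ≤-trans (≤-reflexive (cong (suc ∘ ∣_∣) (Subset.∪-identityˡ p))) (n≤1+n _)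
  ∣⁅x⁆∪p∣≤1+∣p∣ fzero    (false ∷ p) = ≤-reflexive (cong (suc ∘ ∣_∣) (Subset.∪-identityˡ p))
  ∣⁅x⁆∪p∣≤1+∣p∣ (fsuc x) (true  ∷ p) = s≤s (∣⁅x⁆∪p∣≤1+∣p∣ x p)
  ∣⁅x⁆∪p∣≤1+∣p∣ (fsuc x) (false ∷ p) = ∣⁅x⁆∪p∣≤1+∣p∣ x p

  ∣toSubset∣ : ∀ vs → ∣ toSubset vs ∣ ≤ length vs
  ∣toSubset∣ []       = ≤-reflexive (Subset.∣⊥∣≡0 (ord G))
  ∣toSubset∣ (v ∷ vs) = ≤-trans (∣⁅x⁆∪p∣≤1+∣p∣ v (toSubset vs)) (s≤s (∣toSubset∣ vs))

  map-WalkIn : ∀ {T : Graph} {P Q : Fin (ord T) → Set} → (∀ {x} → P x → Q x) → ∀ {a b} → WalkIn T P a b → WalkIn T Q a b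
  map-WalkIn f (stop x)   = stop (f x)
  map-WalkIn f (go x e w) = go (f x) e (map-WalkIn f w)

  decomposition : ∀ {m} (T : RootedTree m) → (∀ v → Covered T v) →
                  (∀ {u v} → u ~ v → ∃[ t ] (u ∈ bag-at T t × v ∈ bag-at T t)) → TreeDecomposition G
  decomposition T covers edges = record
    { tree = treeGraph T
    ; isTree = record { nonempty = tree-nonempty T ; connected = tree-connected T ; acyclic = tree-acyclic T }
    ; bag = λ t → toSubset (bag-at T t)
    ; coverV = λ v → proj₁ (covers v) , toSubset⁺ (proj₂ (covers v))
    ; coverE = λ u v e → proj₁ (edges e) , toSubset⁺ (proj₁ (proj₂ (edges e))) , toSubset⁺ (proj₂ (proj₂ (edges e)))
    ; subtree = λ v t t′ i j → map-WalkIn toSubset⁺ (bag-walk T t t′ (toSubset⁻ (bag-at T t) i) (toSubset⁻ (bag-at T t′) j)) }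

  reach-avoiding? : ∀ Z a b → Dec (Reach (_∉ Z) a b)
  reach-avoiding? Z = reach? (λ v → ¬? (v ∈? Z))

  side : List V → V → List V → List V
  side Z v W = filter (reach-avoiding? Z v) W

  -- Balanced separators of `W`: `side Z v W` is the part of `W` in the component of `v` after the
  -- deletion of `Z`.
  Balanced : ℕ → List V → List V → Set
  Balanced θ W Z = length Z ≤ θ × (∀ v → v ∉ Z → 2 * length (side Z v W) ≤ length W)

  module Grow (θ : ℕ) (1≤θ : 1 ≤ θ) {F : Set}
    (separate : ∀ W → length W ≤ suc (3 * θ) → F ⊎ ∃[ Z ] Balanced θ W Z) where

    Uncovered : ∀ {m} → RootedTree m → V → Set
    Uncovered T v = ¬ Covered T v

    -- The invariant of the growth is `frontier`: the covered neighbours of a component of uncovered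
    -- vertices are few and lie in one bag, so a leaf for that component can be attached there.
    record State : Set where
      field
        {nodes}  : ℕ
        rt       : RootedTree nodes
        small    : ∀ t → length (bag-at rt t) ≤ suc (4 * θ)
        edges    : ∀ {u v} → Covered rt u → Covered rt v → u ~ v → ∃[ t ] (u ∈ bag-at rt t × v ∈ bag-at rt t)
        frontier : ∀ {v} → Uncovered rt v → ∃[ p ] ∃[ W ] (length W ≤ 3 * θ × (∀ {w} → w ∈ W → w ∈ bag-at rt p) ×
                     (∀ {v′ y} → Reach (Uncovered rt) v v′ → Covered rt y → v′ ~ y → y ∈ W))
    open State

    initial : State
    initial = record
      { rt = root ; small = λ _ → z≤n ; edges = λ ()
      ; frontier = λ _ → fzero , [] , z≤n , (λ ()) , λ _ () }

    Extends : State → State → Set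
    Extends S S′ = ∀ {v} → Covered (rt S) v → Covered (rt S′) v

    -- The new bag consists of `v`, `W` and part of a balanced separator of `v ∷ W`, at most
    -- `1 + 3 * θ + θ` vertices. A component that remains uncovered sees at most half of `v ∷ W` and
    -- the separator, hence at most `2 * θ + θ` vertices, which restores the invariant.
    cover : ∀ S v → Uncovered (rt S) v → F ⊎ ∃[ S′ ] (Extends S S′ × Covered (rt S′) v)
    cover S v v∉ with p , W , W≤ , W⊆ , inW ← frontier S v∉ with separate (v ∷ W) (s≤s W≤)
    ... | inj₁ fail = inj₁ fail
    ... | inj₂ (Z , Z≤ , balanced) = inj₂ (S′ , (λ (t , i) → fsuc t , i) , (fzero , here refl))
      where
      T₀ = rt S

      Comp : V → Set
      Comp = Reach (Uncovered T₀) v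

      comp? : Decidable Comp
      comp? = reach? (λ x → ¬? (covered? T₀ x)) v

      near? : Decidable (λ z → Comp z ⊎ z ∈ W)
      near? z = comp? z ⊎-dec (z ∈? W)

      -- Separator vertices elsewhere are dropped: a covered one outside `W` need not lie in the bag
      -- of the parent, and an uncovered one in another component would alter the frontier there.
      ZB B : List V
      ZB = filter near? Z
      B  = (v ∷ W) ++ ZB

      old : ∀ {x} → x ∈ B → Covered T₀ x → x ∈ W
      old x∈ x-cov with ∈-++⁻ (v ∷ W) x∈
      ... | inj₁ (here refl) = ⊥-elim (v∉ x-cov)
      ... | inj₁ (there i)   = i
      ... | inj₂ i with proj₂ (∈-filter⁻ near? {xs = Z} i)
      ...   | inj₁ r = ⊥-elim (target∈ r x-cov)
      ...   | inj₂ j = j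

      new : ∀ {x} → x ∈ B → Uncovered T₀ x → Comp x
      new x∈ x-unc with ∈-++⁻ (v ∷ W) x∈
      ... | inj₁ (here refl) = reach-refl v∉
      ... | inj₁ (there i)   = ⊥-elim (x-unc (p , W⊆ i))
      ... | inj₂ i with proj₂ (∈-filter⁻ near? {xs = Z} i)
      ...   | inj₁ r = r
      ...   | inj₂ j = ⊥-elim (x-unc (p , W⊆ j))

      T₁ = leaf T₀ p B (λ i c → W⊆ (old i c))

      new-cov : ∀ {x} → Covered T₁ x → Uncovered T₀ x → x ∈ B
      new-cov (fzero , i)  _   = i
      new-cov (fsuc t , i) unc = ⊥-elim (unc (t , i))

      unc⁻ : ∀ {x} → Uncovered T₁ x → Uncovered T₀ x
      unc⁻ unc (t , i) = unc (fsuc t , i)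

      small₁ : ∀ t → length (bag-at T₁ t) ≤ suc (4 * θ)
      small₁ fzero    = begin
        length B                   ≡⟨ List.length-++ (v ∷ W) ⟩
        suc (length W + length ZB) ≤⟨ s≤s (+-mono-≤ W≤ (≤-trans (List.length-filter near? Z) Z≤)) ⟩
        suc (3 * θ + θ)            ≡⟨ cong suc (+-comm (3 * θ) θ) ⟩
        suc (4 * θ)                ∎
        where open ≤-Reasoning
      small₁ (fsuc t) = small S t

      B-edge : ∀ {u w} → Covered T₁ u → Covered T₁ w → Uncovered T₀ u → u ~ w → w ∈ B
      B-edge {u} {w} cu cw unc e with covered? T₀ w
      ... | no w-unc = new-cov cw w-unc
      ... | yes w-cov = ∈-++⁺ˡ (there (inW (new (new-cov cu unc) unc) w-cov e))

      edges₁ : ∀ {u w} → Covered T₁ u → Covered T₁ w → u ~ w → ∃[ t ] (u ∈ bag-at T₁ t × w ∈ bag-at T₁ t)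
      edges₁ {u} {w} cu cw e with covered? T₀ u | covered? T₀ w
      ... | no u-unc | _ = fzero , new-cov cu u-unc , B-edge cu cw u-unc e
      ... | yes _ | no w-unc = fzero , B-edge cw cu w-unc (~-sym e) , new-cov cw w-unc
      ... | yes u-cov | yes w-cov with t , i , j ← edges S u-cov w-cov e = fsuc t , i , j

      frontier₁ : ∀ {v′} → Uncovered T₁ v′ → ∃[ q ] ∃[ W′ ] (length W′ ≤ 3 * θ × (∀ {w} → w ∈ W′ → w ∈ bag-at T₁ q) ×
                    (∀ {x y} → Reach (Uncovered T₁) v′ x → Covered T₁ y → x ~ y → y ∈ W′))
      frontier₁ {v′} v′-unc with comp? v′
      -- Another component keeps its frontier: a newly covered neighbour would lie in the component
      -- of `v` and draw `v′` into it.
      ... | no other with q , W′ , W′≤ , W′⊆ , inW′ ← frontier S (unc⁻ v′-unc) = fsuc q , W′ , W′≤ , W′⊆ , inW′₁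
        where
        inW′₁ : ∀ {x y} → Reach (Uncovered T₁) v′ x → Covered T₁ y → x ~ y → y ∈ W′
        inW′₁ {x} {y} r cy e with covered? T₀ y
        ... | yes y-cov = inW′ (map-reach unc⁻ r) y-cov e
        ... | no y-unc = ⊥-elim (other (reach-trans (new (new-cov cy y-unc) y-unc)
                (reach-trans (reach-edge y-unc (target∈ r′) (~-sym e)) (reach-sym r′))))
          where r′ = map-reach unc⁻ r
      ... | yes same = fzero , W′ , W′≤ , W′⊆ , inW′
        where
        W′ : List V
        W′ = side Z v′ (v ∷ W) ++ ZB

        comp-off-Z : ∀ {x} → Comp x → Uncovered T₁ x → x ∉ Z
        comp-off-Z r unc x∈Z = unc (fzero , ∈-++⁺ʳ (v ∷ W) (∈-filter⁺ near? x∈Z (inj₁ r)))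

        walk-off-Z : ∀ {k a b} → Walk (Uncovered T₁) k a b → Comp a → Reach (_∉ Z) a b
        walk-off-Z (nil unc)      r = reach-refl (comp-off-Z r unc)
        walk-off-Z (cons unc e w) r = reach-trans (reach-edge (comp-off-Z r unc) (comp-off-Z r′ (source∈ w)) e) (walk-off-Z w r′)
          where r′ = reach-trans r (reach-edge (target∈ r) (unc⁻ (source∈ w)) e)

        W′⊆ : ∀ {w} → w ∈ W′ → w ∈ B
        W′⊆ i with ∈-++⁻ (side Z v′ (v ∷ W)) i
        ... | inj₁ j = ∈-++⁺ˡ (proj₁ (∈-filter⁻ (reach-avoiding? Z v′) {xs = v ∷ W} j))
        ... | inj₂ j = ∈-++⁺ʳ (v ∷ W) j

        inW′ : ∀ {x y} → Reach (Uncovered T₁) v′ x → Covered T₁ y → x ~ y → y ∈ W′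
        inW′ {x} {y} r cy e with y ∈? Z
        ... | yes y∈Z = ∈-++⁺ʳ (side Z v′ (v ∷ W)) (∈-filter⁺ near? y∈Z near)
          where
          rx = reach-trans same (map-reach unc⁻ r)
          near : Comp y ⊎ y ∈ W
          near with covered? T₀ y
          ... | yes y-cov = inj₂ (inW rx y-cov e)
          ... | no  y-unc = inj₁ (reach-trans rx (reach-edge (target∈ rx) y-unc e))
        ... | no y∉Z = ∈-++⁺ˡ (∈-filter⁺ (reach-avoiding? Z v′) y∈vW reachy)
          where
          rx = reach-trans same (map-reach unc⁻ r)
          reachy : Reach (_∉ Z) v′ y
          reachy = reach-trans rz (reach-edge (target∈ rz) y∉Z e)
            where rz = walk-off-Z (proj₂ r) same
          y∈vW : y ∈ v ∷ W
          y∈vW with covered? T₀ y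
          ... | yes y-cov = there (inW rx y-cov e)
          ... | no  y-unc with ∈-++⁻ (v ∷ W) (new-cov cy y-unc)
          ...   | inj₁ i = i
          ...   | inj₂ i = ⊥-elim (y∉Z (proj₁ (∈-filter⁻ near? {xs = Z} i)))

        W′≤ : length W′ ≤ 3 * θ
        W′≤ = begin
          length W′                                    ≡⟨ List.length-++ (side Z v′ (v ∷ W)) ⟩
          length (side Z v′ (v ∷ W)) + length ZB       ≤⟨ +-mono-≤ half (≤-trans (List.length-filter near? Z) Z≤) ⟩
          2 * θ + θ                                    ≡⟨ +-comm (2 * θ) θ ⟩
          3 * θ                                        ∎
          where
          open ≤-Reasoning
          half : length (side Z v′ (v ∷ W)) ≤ 2 * θ
          -- `v ∷ W` has at most `3 * θ + 1` vertices, which is at most `4 * θ` because `1 ≤ θ`.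
          half = *-cancelˡ-≤ 2 (begin
            2 * length (side Z v′ (v ∷ W)) ≤⟨ balanced v′ (comp-off-Z same v′-unc) ⟩
            suc (length W)                 ≤⟨ +-mono-≤ 1≤θ W≤ ⟩
            4 * θ                          ≡⟨ *-assoc 2 2 θ ⟩
            2 * (2 * θ)                    ∎)

      S′ : State
      S′ = record { rt = T₁ ; small = small₁ ; edges = edges₁ ; frontier = frontier₁ }

    cover-all : ∀ vs S → F ⊎ ∃[ S′ ] (Extends S S′ × (∀ {v} → v ∈ vs → Covered (rt S′) v))
    cover-all []       S = inj₂ (S , id , λ ())
    cover-all (v ∷ vs) S with cover-all vs S
    ... | inj₁ fail = inj₁ fail
    ... | inj₂ (S₁ , ext , done) with covered? (rt S₁) v
    ...   | yes c = inj₂ (S₁ , ext , λ { (here refl) → c ; (there i) → done i })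
    ...   | no  c with cover S₁ v c
    ...     | inj₁ fail = inj₁ fail
    ...     | inj₂ (S₂ , ext₂ , c₂) = inj₂ (S₂ , ext₂ ∘ ext , λ { (here refl) → c₂ ; (there i) → ext₂ (done i) })

    -- Every bag has at most `suc (4 * θ)` vertices, one fewer than the treewidth hypothesis demands
    -- of some bag.
    fail-or-decompose : TreewidthAtLeast (suc (4 * θ)) G → F
    fail-or-decompose tw with cover-all (allFin (ord G)) initial
    ... | inj₁ fail = fail
    ... | inj₂ (S , _ , done) with t , big ← tw (decomposition (rt S) (λ v → done (∈-allFin v))
                                                   (edges S (done (∈-allFin _)) (done (∈-allFin _)))) =
      ⊥-elim (<-irrefl refl (≤-trans big (≤-trans (∣toSubset∣ (bag-at (rt S) t)) (small S t))))

-- The big component and attached vertices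

module _ {A : Set} {P Q : A → Set} (P? : Decidable P) (Q? : Decidable Q) where

  length-filter-mono : (∀ {x} → P x → Q x) → ∀ xs → length (filter P? xs) ≤ length (filter Q? xs)
  length-filter-mono P⊆Q []       = z≤n
  length-filter-mono P⊆Q (x ∷ xs) with ih ← length-filter-mono P⊆Q xs with P? x | Q? x
  ... | yes _ | yes _  = s≤s ih
  ... | yes p | no ¬q  = ⊥-elim (¬q (P⊆Q p))
  ... | no _  | yes _  = m≤n⇒m≤1+n ih
  ... | no _  | no _   = ih

  length-filter-strict : (∀ {x} → P x → Q x) → ∀ {x xs} → x ∈ xs → ¬ P x → Q x →
                         length (filter P? xs) < length (filter Q? xs)
  length-filter-strict P⊆Q {x} {_ ∷ xs} (here refl) ¬p q with P? x | Q? x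
  ... | yes p | _     = ⊥-elim (¬p p)
  ... | no _  | yes _ = s≤s (length-filter-mono P⊆Q xs)
  ... | no _  | no ¬q = ⊥-elim (¬q q)
  length-filter-strict P⊆Q {x} {y ∷ xs} (there i) ¬p q with ih ← length-filter-strict P⊆Q i ¬p q with P? y | Q? y
  ... | yes _ | yes _  = s≤s ih
  ... | yes p | no ¬q  = ⊥-elim (¬q (P⊆Q p))
  ... | no _  | yes _  = m≤n⇒m≤1+n ih
  ... | no _  | no _   = ih

  length-filter-disjoint : (∀ {x} → P x → ¬ Q x) → ∀ xs → length (filter P? xs) + length (filter Q? xs) ≤ length xs
  length-filter-disjoint P∩Q []       = z≤n
  length-filter-disjoint P∩Q (x ∷ xs) with ih ← length-filter-disjoint P∩Q xs with P? x | Q? x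
  ... | yes p | yes q = ⊥-elim (P∩Q p q)
  ... | yes _ | no _  = s≤s ih
  ... | no _  | yes _ = ≤-trans (≤-reflexive (+-suc _ _)) (s≤s ih)
  ... | no _  | no _  = m≤n⇒m≤1+n ih

length-concatMap : ∀ {A B : Set} (f : A → List B) k → (∀ x → length (f x) ≤ k) → ∀ xs → length (concatMap f xs) ≤ length xs * k
length-concatMap f k f≤ []       = z≤n
length-concatMap f k f≤ (x ∷ xs) =
  subst (_≤ k + length xs * k) (sym (List.length-++ (f x))) (+-mono-≤ (f≤ x) (length-concatMap f k f≤ xs))

-- This decides the existence of small separators, so the later case distinctions need no classical
-- axiom.
anyList? : ∀ {m} {P : List (Fin m) → Set} → Decidable P → ∀ k → Dec (∃[ xs ] (length xs ≤ k × P xs))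
anyList? P? zero with P? []
... | yes p = yes ([] , z≤n , p)
... | no ¬p = no λ { ([] , _ , p) → ¬p p }
anyList? P? (suc k) with P? [] | Fin.any? (λ x → anyList? (λ xs → P? (x ∷ xs)) k)
... | yes p | _ = yes ([] , z≤n , p)
... | no ¬p | yes (x , xs , le , p) = yes (x ∷ xs , s≤s le , p)
... | no ¬p | no ¬q = no λ { ([] , _ , p) → ¬p p ; (x ∷ xs , s≤s le , p) → ¬q (x , xs , le , p) }

module Majority (G : Graph) (W : List (Fin (ord G))) where
  open Walks G
  open DecMembership (Fin._≟_ {ord G}) using (_∈?_)
  open TreeBuilding G using (reach-avoiding?; side)

  Big : List V → V → Set
  Big Z v = v ∉ Z × length W < 2 * length (side Z v W)

  abstract
    big? : ∀ Z → Decidable (Big Z)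
    big? Z v = ¬? (v ∈? Z) ×-dec (length W <? 2 * length (side Z v W))

  -- Distinct components are disjoint and cannot both contain more than half of `W`. Hence the big
  -- component is unique.
  big-connected : ∀ {Z u v} → Big Z u → Big Z v → Reach (_∉ Z) u v
  big-connected {Z} {u} {v} (_ , bu) (_ , bv) with reach-avoiding? Z u v
  ... | yes r = r
  ... | no ¬r = ⊥-elim (<-irrefl refl (begin-strict
    length W + length W                                 <⟨ +-mono-< bu bv ⟩
    2 * length (side Z u W) + 2 * length (side Z v W)   ≡⟨ sym (*-distribˡ-+ 2 (length (side Z u W)) _) ⟩
    2 * (length (side Z u W) + length (side Z v W))     ≤⟨ *-monoʳ-≤ 2 (length-filter-disjoint
                                                             (reach-avoiding? Z u) (reach-avoiding? Z v)
                                                             (λ ru rv → ¬r (reach-trans ru (reach-sym rv))) W) ⟩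
    2 * length W                                        ≡⟨ cong (length W +_) (+-identityʳ (length W)) ⟩
    length W + length W                                 ∎))
    where open ≤-Reasoning

  -- `side` can only grow when everything reachable from `u` becomes reachable from `v`. Changes of
  -- the vertex and of the deleted set both reduce to this.
  big-via : ∀ {Z Z′ u v} → Big Z u → v ∉ Z′ → (∀ {w} → Reach (_∉ Z) u w → Reach (_∉ Z′) v w) → Big Z′ v
  big-via {Z} {Z′} {u} {v} (_ , b) v∉ f =
    v∉ , <-≤-trans b (*-monoʳ-≤ 2 (length-filter-mono (reach-avoiding? Z u) (reach-avoiding? Z′ v) f W))

  big-reach : ∀ {Z u v} → Big Z u → Reach (_∉ Z) u v → Big Z v
  big-reach b r = big-via b (target∈ r) (reach-trans (reach-sym r))

  big-edge : ∀ {Z u v} → Big Z u → v ∉ Z → u ~ v → Big Z v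
  big-edge b@(u∉ , _) v∉ e = big-reach b (reach-edge u∉ v∉ e)

  big-shrink : ∀ {Z Z′ v} → (∀ {x} → x ∈ Z → x ∈ Z′) → Big Z′ v → Big Z v
  big-shrink Z⊆ b@(v∉ , _) = big-via b (v∉ ∘ Z⊆) (map-reach (_∘ Z⊆))

  module Haven (θ : ℕ) (haven : ∀ Z → length Z ≤ θ → ∃[ v ] Big Z v) where

    -- A vertex v that is separated by a single z leads to z, whose big component
    -- (with z removed) is strictly smaller than that of v.
    unseparated : ∀ X U → (∀ {x} → x ∈ X → x ∈ U) → suc (length X) ≤ θ → length U ≤ θ →
                  ∃[ v ] (Big U v × (∀ z → z ≢ v → Big (z ∷ X) v))
    unseparated X U X⊆U X< U≤ with v , bv ← haven U U≤ = <-rec Goal rec (μ v) v refl bv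
      where
      μ : V → ℕ
      μ v = length (filter (big? (v ∷ X)) (allFin (ord G)))
      Goal : ℕ → Set
      Goal k = ∀ v → k ≡ μ v → Big U v → ∃[ v ] (Big U v × (∀ z → z ≢ v → Big (z ∷ X) v))
      rec : ∀ k → (∀ {j} → j < k → Goal j) → Goal k
      rec _ ih v refl bv with Fin.any? (λ z → ¬? (z Fin.≟ v) ×-dec ¬? (big? (z ∷ X) v))
      ... | no none = v , bv , λ z z≢v → decidable-stable (big? (z ∷ X) v) λ ¬b → none (z , z≢v , ¬b)
      ... | yes (z , z≢v , ¬b) = ih (length-filter-strict (big? (z ∷ X)) (big? (v ∷ X)) Cz⊆Cv (∈-allFin z)
                                       (λ (z∉ , _) → z∉ (here refl)) z∈Cv) z refl bz
        where
        v∉z∷X : v ∉ z ∷ X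
        v∉z∷X (here eq) = z≢v (sym eq)
        v∉z∷X (there i) = proj₁ bv (X⊆U i)

        -- Otherwise the component of `v` without `U` would miss `z`, hence survive the deletion of
        -- `z ∷ X`, and `v` would be big there.
        bz : Big U z
        bz with big? U z
        ... | yes b = b
        ... | no ¬bz = ⊥-elim (¬b (big-via bv v∉z∷X λ (_ , w) → avoid w bv))
          where
          off : ∀ {a} → Big U a → a ∉ z ∷ X
          off ba (here refl) = ¬bz ba
          off ba (there i)   = proj₁ ba (X⊆U i)
          avoid : ∀ {k a b} → Walk (_∉ U) k a b → Big U a → Reach (_∉ z ∷ X) a b
          avoid (nil _)      ba = reach-refl (off ba)
          avoid (cons _ e w) ba = reach-trans (reach-edge (off ba) (off ba′) e) (avoid w ba′)
            where ba′ = big-edge ba (source∈ w) e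

        off-v : ∀ {a} → Big (z ∷ X) a → a ∉ v ∷ X
        off-v ba (here refl) = ¬b ba
        off-v ba (there i)   = proj₁ ba (there i)

        -- The big component of `z ∷ X` misses `v` by `¬b`, so it stays connected when `v` is
        -- deleted in place of `z`.
        Cz⊆Cv : ∀ {w} → Big (z ∷ X) w → Big (v ∷ X) w
        Cz⊆Cv bw = big-via bw (off-v bw) λ (_ , p) → avoid p bw
          where
          avoid : ∀ {k a b} → Walk (_∉ z ∷ X) k a b → Big (z ∷ X) a → Reach (_∉ v ∷ X) a b
          avoid (nil _)      ba = reach-refl (off-v ba)
          avoid (cons _ e p) ba = reach-trans (reach-edge (off-v ba) (off-v ba′) e) (avoid p ba′)
            where ba′ = big-edge ba (source∈ p) e

        -- The walk first enters `z` from a vertex in the big component of `z ∷ X`, which is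
        -- contained in that of `v ∷ X`. So `z` belongs to the latter, and the inclusion is strict.
        first-hit : ∀ {k a} → Walk (_∉ X) k a z → Big (z ∷ X) a → Big (v ∷ X) z
        first-hit (nil _) ba = ⊥-elim (proj₁ ba (here refl))
        first-hit (cons {b = b} _ e p) ba with b Fin.≟ z
        ... | yes refl = big-edge (Cz⊆Cv ba) (λ { (here eq) → z≢v eq ; (there i) → source∈ p i }) e
        ... | no b≢z = first-hit p (big-edge ba (λ { (here eq) → b≢z eq ; (there i) → source∈ p i }) e)

        z∈Cv : Big (v ∷ X) z
        z∈Cv with c , bc ← haven (z ∷ X) X< =
          first-hit (proj₂ (big-connected (big-shrink there bc) (big-shrink X⊆U bz))) bc

    module Attachment (s k : ℕ) where
      open Diameter G s

      Separable : V → Set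
      Separable v = ∃[ Z ] (length Z ≤ k × (v ∉ Z × ¬ Big Z v))

      abstract
        separable? : Decidable Separable
        separable? v = anyList? (λ Z → ¬? (v ∈? Z) ×-dec ¬? (big? Z v)) k

      attached : List V
      attached = filter (¬? ∘ separable?) (allFin (ord G))

      attached-big : ∀ {v Z} → v ∈ attached → length Z ≤ k → v ∉ Z → Big Z v
      attached-big {v} {Z} i Z≤ v∉ = decidable-stable (big? Z v) λ ¬b →
        proj₂ (∈-filter⁻ (¬? ∘ separable?) {xs = allFin (ord G)} i) (Z , Z≤ , v∉ , ¬b)

      -- After the deletion of `z ∷ X` both vertices are in the unique big component. Hence no
      -- single `z` separates them outside `X`, and `diameter` applies.
      robust-walk : ∀ {u v X} → (∀ z → z ≢ u → Big (z ∷ X) u) → (∀ z → z ≢ v → Big (z ∷ X) v) → Big X u → Big X v →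
                    ContainsCanonical s G ⊎ ∃[ d ] (d ≤ diam s × Walk (_∉ X) d u v)
      robust-walk {X = X} bu bv bu₀ bv₀ = diameter (λ v → ¬? (v ∈? X)) (big-connected bu₀ bv₀)
        λ z z≢u z≢v → map-reach (λ x∉ → (λ i → x∉ (there i)) , λ eq → x∉ (here eq)) (big-connected (bu z z≢u) (bv z z≢v))

      short-walk : ∀ {x y F} → x ∈ attached → y ∈ attached → suc (length F) ≤ k → x ∉ F → y ∉ F →
                   ContainsCanonical s G ⊎ ∃[ d ] (d ≤ diam s × Walk (_∉ F) d x y)
      short-walk {F = F} x∈ y∈ F< x∉ y∉ = robust-walk (free x∈ x∉) (free y∈ y∉)
          (attached-big x∈ (<⇒≤ F<) x∉) (attached-big y∈ (<⇒≤ F<) y∉)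
        where
        free : ∀ {x} → x ∈ attached → x ∉ F → ∀ z → z ≢ x → Big (z ∷ F) x
        free x∈ x∉ z z≢x = attached-big x∈ F< λ { (here eq) → z≢x (sym eq) ; (there i) → x∉ i }

      cut : V → List V
      cut v with separable? v
      ... | yes (Z , _) = Z
      ... | no _        = []

      length-cut : ∀ v → length (cut v) ≤ k
      length-cut v with separable? v
      ... | yes (_ , le , _) = le
      ... | no _             = z≤n

      cut-separates : ∀ {v} → v ∉ attached → v ∉ cut v × ¬ Big (cut v) v
      cut-separates {v} v∉ with separable? v
      ... | yes (_ , _ , sep) = sep
      ... | no ¬sep           = ⊥-elim (v∉ (∈-filter⁺ (¬? ∘ separable?) (∈-allFin v) ¬sep))

      -- Each set also contains the cuts of the vertices of the previous one. Therefore the big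
      -- component left by `layer v (suc r)` has no neighbours in `layer v r` other than attached
      -- vertices.
      layer : V → ℕ → List V
      layer v zero    = v ∷ attached
      layer v (suc r) = layer v r ++ concatMap cut (layer v r)

      layer-base : ∀ {v x} r → x ∈ layer v zero → x ∈ layer v r
      layer-base zero    i = i
      layer-base (suc r) i = ∈-++⁺ˡ (layer-base r i)

      length-layer : ∀ v r → length (layer v r) ≤ suc k ^ r * suc (length attached)
      length-layer v zero    = ≤-reflexive (sym (+-identityʳ _))
      length-layer v (suc r) = begin
        length (layer v (suc r))                             ≡⟨ List.length-++ (layer v r) ⟩
        length (layer v r) + length (concatMap cut (layer v r)) ≤⟨ +-monoʳ-≤ _ (length-concatMap cut k length-cut (layer v r)) ⟩
        length (layer v r) + length (layer v r) * k          ≡⟨ sym (*-suc (length (layer v r)) k) ⟩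
        length (layer v r) * suc k                           ≡⟨ *-comm (length (layer v r)) (suc k) ⟩
        suc k * length (layer v r)                           ≤⟨ *-monoʳ-≤ (suc k) (length-layer v r) ⟩
        suc k * (suc k ^ r * suc (length attached))          ≡⟨ sym (*-assoc (suc k) (suc k ^ r) _) ⟩
        suc k ^ suc r * suc (length attached)                ∎
        where open ≤-Reasoning

      -- Outside the layer the walk stays in the big component. A step into `layer v (suc r)` cannot
      -- lead to `layer v r`, since the cut of the vertex entered would then fail to separate it. So
      -- that vertex is still big for `layer v r`, and every layer costs an edge.
      layer-distance : ∀ {v u d} r → Walk (_∉ attached) d u v → Big (layer v r) u → r < d
      layer-distance r (nil _) (u∉ , _) = ⊥-elim (u∉ (layer-base r (here refl)))
      layer-distance {v} r (cons {b = b} _ e w) bu with b ∈? layer v r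
      layer-distance r (cons _ e w) bu | no b∉ = m≤n⇒m≤1+n (layer-distance r w (big-edge bu b∉ e))
      layer-distance zero (cons _ e w) bu | yes _ = z<s
      layer-distance {v} (suc r) (cons {b = b} _ e w) bu | yes _ with b ∈? layer v r
      ... | no b∉ = s≤s (layer-distance r w (big-edge (big-shrink ∈-++⁺ˡ bu) b∉ e))
      ... | yes b∈ with b∉cut , ¬b ← cut-separates (source∈ w) =
        ⊥-elim (¬b (big-edge (big-shrink cut⊆ bu) b∉cut e))
        where
        cut⊆ : ∀ {x} → x ∈ cut b → x ∈ layer v (suc r)
        cut⊆ i = ∈-++⁺ʳ (layer v r) (∈-concatMap⁺ cut (Any.map (λ { refl → i }) b∈))

      room : suc k ^ diam s * suc (length attached) ≤ θ → suc (length attached) ≤ θ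
      room = ≤-trans (m≤n*m (suc (length attached)) (suc k ^ diam s) {{m^n≢0 (suc k) (diam s)}})

      -- Both `v` and `u` are unseparated after the deletion of `attached`, and `u` is moreover big
      -- beyond `layer v (diam s)`. Without a canonical graph, `robust-walk` puts them at distance
      -- at most `diam s`, against `layer-distance`.
      few-attached : suc k ^ diam s * suc (length attached) ≤ θ → ContainsCanonical s G
      few-attached bound
        with v , bv , free-v ← unseparated attached attached id (room bound) (<⇒≤ (room bound))
        with u , bu , free-u ← unseparated attached (layer v (diam s)) (λ i → layer-base (diam s) (there i)) (room bound)
                                 (≤-trans (length-layer v (diam s)) bound)
        with robust-walk free-u free-v (big-shrink (λ i → layer-base (diam s) (there i)) bu) bv
      ... | inj₁ canonical = canonical
      ... | inj₂ (d , d≤ , w) = ⊥-elim (<-irrefl refl (<-≤-trans (layer-distance (diam s) w bu) d≤))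

-- Ramsey's theorem for increasing tuples

Increasing : ∀ {A : Set} r → (Vec A r → Set) → List A → Set
Increasing zero    R xs       = R []
Increasing (suc r) R []       = ⊤
Increasing (suc r) R (x ∷ xs) = Increasing r (R ∘ (x ∷_)) xs × Increasing (suc r) R xs

Homogeneous : ∀ {A : Set} r → (Vec A r → Set) → List A → Set
Homogeneous r R xs = Increasing r R xs ⊎ Increasing r (¬_ ∘ R) xs

increasing-⊑ : ∀ {A : Set} r {R : Vec A r → Set} {xs ys} → ys ⊑ xs → Increasing r R xs → Increasing r R ys
increasing-⊑ zero    _          h       = h
increasing-⊑ (suc r) []         h       = h
increasing-⊑ (suc r) (_ ∷ʳ s)   (_ , h) = increasing-⊑ (suc r) s h
increasing-⊑ (suc r) (refl ∷ s) (g , h) = increasing-⊑ r s g , increasing-⊑ (suc r) s h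

homogeneous-⊑ : ∀ {A : Set} r {R : Vec A r → Set} {xs ys} → ys ⊑ xs → Homogeneous r R xs → Homogeneous r R ys
homogeneous-⊑ r s = Sum.map (increasing-⊑ r s) (increasing-⊑ r s)

-- The truth value of `R` on an increasing tuple depends only on its first entry.
EndHomogeneous : ∀ {A : Set} r → (Vec A (suc r) → Set) → List A → Set
EndHomogeneous r R []       = ⊤
EndHomogeneous r R (x ∷ xs) = Homogeneous r (R ∘ (x ∷_)) xs × EndHomogeneous r R xs

split-colours : ∀ {A : Set} r {R : Vec A (suc r) → Set} xs → EndHomogeneous r R xs →
  ∃[ ts ] ∃[ fs ] (ts ⊑ xs × fs ⊑ xs × length ts + length fs ≡ length xs ×
                   Increasing (suc r) R ts × Increasing (suc r) (¬_ ∘ R) fs)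
split-colours r []       _       = [] , [] , [] , [] , refl , tt , tt
split-colours r (x ∷ xs) (h , e) with ts , fs , t⊑ , f⊑ , len , ti , fi ← split-colours r xs e with h
... | inj₁ g = x ∷ ts , fs , refl ∷ t⊑ , x ∷ʳ f⊑ , cong suc len , (increasing-⊑ r t⊑ g , ti) , fi
... | inj₂ g = ts , x ∷ fs , x ∷ʳ t⊑ , refl ∷ f⊑ , trans (+-suc (length ts) (length fs)) (cong suc len) ,
               ti , (increasing-⊑ r f⊑ g , fi)

half-large : ∀ {m a b} → m + m ≤ a + b → m ≤ a ⊎ m ≤ b
half-large {m} {a} {b} le with m ≤? a
... | yes m≤a = inj₁ m≤a
... | no  m≰a = inj₂ (≮⇒≥ λ b<m → <-irrefl refl (<-≤-trans (+-mono-< (≰⇒> m≰a) b<m) le))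

abstract
  ramseyNumber : ℕ → ℕ → ℕ
  endNumber    : ℕ → ℕ → ℕ
  ramseyNumber zero    m = m
  ramseyNumber (suc r) m = endNumber r (m + m)
  endNumber r zero    = 0
  endNumber r (suc l) = suc (ramseyNumber r (endNumber r l))

  -- Erdős-Rado induction: an end-homogeneous sequence of length `m + m` is built by applying the
  -- case of smaller tuples to the remaining elements, once for each first entry; then the more
  -- frequent of the two truth values is kept.
  ramsey : ∀ {A : Set} r m {R : Vec A r → Set} → Decidable R → ∀ xs → ramseyNumber r m ≤ length xs →
           ∃[ ys ] (ys ⊑ xs × m ≤ length ys × Homogeneous r R ys)
  end-ramsey : ∀ {A : Set} r l {R : Vec A (suc r) → Set} → Decidable R → ∀ xs → endNumber r l ≤ length xs →
               ∃[ ys ] (ys ⊑ xs × l ≤ length ys × EndHomogeneous r R ys)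
  ramsey zero    m R? xs le with R? []
  ... | yes p = xs , ⊆-refl , le , inj₁ p
  ... | no ¬p = xs , ⊆-refl , le , inj₂ ¬p
  ramsey (suc r) m R? xs le with ys , y⊑ , ly , e ← end-ramsey r (m + m) R? xs le
                            with ts , fs , t⊑ , f⊑ , len , ti , fi ← split-colours r ys e
                            with half-large (subst (m + m ≤_) (sym len) ly)
  ... | inj₁ m≤ = ts , ⊆-trans t⊑ y⊑ , m≤ , inj₁ ti
  ... | inj₂ m≤ = fs , ⊆-trans f⊑ y⊑ , m≤ , inj₂ fi
  end-ramsey r zero    R? xs       le       = [] , minimum xs , z≤n , tt
  end-ramsey r (suc l) R? (x ∷ xs) (s≤s le) with zs , z⊑ , lz , h ← ramsey r (endNumber r l) (R? ∘ (x ∷_)) xs le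
                                            with ys , y⊑ , ly , e ← end-ramsey r l R? zs lz =
    x ∷ ys , refl ∷ ⊆-trans y⊑ z⊑ , s≤s ly , homogeneous-⊑ r y⊑ h , e

  multiRamseyNumber : ℕ → ℕ → ℕ → ℕ
  multiRamseyNumber r m zero    = m
  multiRamseyNumber r m (suc c) = ramseyNumber r (multiRamseyNumber r m c)

  -- The relations are treated one after the other, as homogeneity passes to subsequences.
  multi-ramsey : ∀ {A I : Set} r m {R : I → Vec A r → Set} → (∀ i → Decidable (R i)) → ∀ is xs →
                 multiRamseyNumber r m (length is) ≤ length xs →
                 ∃[ ys ] (ys ⊑ xs × m ≤ length ys × (∀ {i} → i ∈ is → Homogeneous r (R i) ys))
  multi-ramsey r m R? []       xs le = xs , ⊆-refl , le , λ ()
  multi-ramsey r m R? (i ∷ is) xs le with zs , z⊑ , lz , h ← ramsey r _ (R? i) xs le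
                                     with ys , y⊑ , ly , hs ← multi-ramsey r m R? is zs lz =
    ys , ⊆-trans y⊑ z⊑ , ly , λ { (here refl) → homogeneous-⊑ r y⊑ h ; (there j) → hs j }

unique-⊑ : ∀ {A : Set} {xs ys : List A} → ys ⊑ xs → Unique xs → Unique ys
unique-⊑ []         []       = []
unique-⊑ (_ ∷ʳ s)   (_ ∷ u)  = unique-⊑ s u
unique-⊑ (refl ∷ s) (a ∷ u)  = All-resp-⊆ s a ∷ unique-⊑ s u

module Nth {A : Set} (default : A) where

  nth : List A → ℕ → A
  nth []       _       = default
  nth (x ∷ xs) zero    = x
  nth (x ∷ xs) (suc i) = nth xs i

  nth∈ : ∀ {xs i} → i < length xs → nth xs i ∈ xs
  nth∈ {_ ∷ _} {zero}  _       = here refl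
  nth∈ {_ ∷ _} {suc i} (s≤s q) = there (nth∈ q)

  nth-distinct : ∀ {xs i j} → Unique xs → i < j → j < length xs → nth xs i ≢ nth xs j
  nth-distinct {_ ∷ _} {zero}  {suc j} (x∉ ∷ _) _         (s≤s q) = All.lookup x∉ (nth∈ q)
  nth-distinct {_ ∷ _} {suc i} {suc j} (_ ∷ u)  (s≤s i<j) (s≤s q) = nth-distinct u i<j q

  nth₁ : ∀ xs (R : Vec A 1 → Set) → Increasing 1 R xs → ∀ {i} → i < length xs → R (nth xs i ∷ [])
  nth₁ (_ ∷ _)  R (h , _) {zero}  _       = h
  nth₁ (_ ∷ xs) R (_ , h) {suc i} (s≤s q) = nth₁ xs R h q

  nth₂ : ∀ xs (R : Vec A 2 → Set) → Increasing 2 R xs → ∀ {i j} → i < j → j < length xs → R (nth xs i ∷ nth xs j ∷ [])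
  nth₂ (x ∷ xs) R (h , _) {zero}  {suc j} _       (s≤s q) = nth₁ xs (R ∘ (x ∷_)) h q
  nth₂ (_ ∷ xs) R (_ , h) {suc i} {suc j} (s≤s p) (s≤s q) = nth₂ xs R h p q

  nth₃ : ∀ xs (R : Vec A 3 → Set) → Increasing 3 R xs → ∀ {i j k} → i < j → j < k → k < length xs →
         R (nth xs i ∷ nth xs j ∷ nth xs k ∷ [])
  nth₃ (x ∷ xs) R (h , _) {zero}  {suc j} {suc k} _       (s≤s o) (s≤s q) = nth₂ xs (R ∘ (x ∷_)) h o q
  nth₃ (_ ∷ xs) R (_ , h) {suc i} {suc j} {suc k} (s≤s p) (s≤s o) (s≤s q) = nth₃ xs R h p o q

  nth₄ : ∀ xs (R : Vec A 4 → Set) → Increasing 4 R xs → ∀ {i j k l} → i < j → j < k → k < l → l < length xs →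
         R (nth xs i ∷ nth xs j ∷ nth xs k ∷ nth xs l ∷ [])
  nth₄ (x ∷ xs) R (h , _) {zero}  {suc j} {suc k} {suc l} _       (s≤s n) (s≤s o) (s≤s q) = nth₃ xs (R ∘ (x ∷_)) h n o q
  nth₄ (_ ∷ xs) R (_ , h) {suc i} {suc j} {suc k} {suc l} (s≤s p) (s≤s n) (s≤s o) (s≤s q) = nth₄ xs R h p n o q

-- Linking hubs by short paths

length-cartesianProduct : ∀ {A B : Set} (xs : List A) (ys : List B) → length (cartesianProduct xs ys) ≡ length xs * length ys
length-cartesianProduct []       ys = refl
length-cartesianProduct (x ∷ xs) ys =
  trans (List.length-++ (Data.List.map (x ,_) ys)) (cong₂ _+_ (List.length-map (x ,_) ys) (length-cartesianProduct xs ys))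

module Linkages (G : Graph) (D : ℕ) (Xs : List (Fin (ord G))) where
  open Walks G
  open DecMembership (Fin._≟_ {ord G}) using (_∈?_)

  record Path : Set where
    constructor path
    field
      len : ℕ
      at  : ℕ → V
  open Path public

  Joins : V × V → Path → Set
  Joins (x , y) p = at p 0 ≡ x × at p (len p) ≡ y × len p ≤ D × (∀ {i} → i < len p → at p i ~ at p (suc i)) ×
                    (∀ {i} → i ≤ len p → at p i ≡ x ⊎ at p i ≡ y ⊎ at p i ∉ Xs)

  Apart : Path → Path → Set
  Apart p p′ = ∀ {i j} → i ≤ len p → j ≤ len p′ → at p i ≡ at p′ j → at p i ∈ Xs

  Linkage : List (V × V) → Set
  Linkage es = Σ (V × V → Path) λ P → (∀ {e} → e ∈ es → Joins e (P e)) ×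
    (∀ e e′ → e ∈ es → e′ ∈ es → e ≢ e′ → Apart (P e) (P e′))

  _≟ₑ_ : (e e′ : V × V) → Dec (e ≡ e′)
  _≟ₑ_ = ≡-dec Fin._≟_ Fin._≟_

  open DecMembership _≟ₑ_ using () renaming (_∈?_ to _∈ₑ?_)

  vertices : Path → List V
  vertices p = applyUpTo (at p) (suc (len p))

  at∈vertices : ∀ p {i} → i ≤ len p → at p i ∈ vertices p
  at∈vertices p i≤ = ∈-applyUpTo⁺ (at p) (s≤s i≤)

  _[_↦_] : (V × V → Path) → V × V → Path → V × V → Path
  (P [ e ↦ p ]) e′ with e′ ≟ₑ e
  ... | yes _ = p
  ... | no _  = P e′

  module _ {C : Set} {k : ℕ}
    (short-walk : ∀ {x y F} → x ∈ Xs → y ∈ Xs → suc (length F) ≤ k → x ∉ F → y ∉ F →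
                  C ⊎ ∃[ d ] (d ≤ D × Walk (_∉ F) d x y)) where

    -- Greedy choice: a new link avoids all hubs and all earlier links except at its own ends. The
    -- bound on `k` counts the hubs and `suc D` vertices for each link, so `short-walk` applies to
    -- the forbidden set.
    linkage : ∀ es → (∀ {x y} → (x , y) ∈ es → x ∈ Xs × y ∈ Xs) → suc (length Xs + length es * suc D) ≤ k → C ⊎ Linkage es
    -- No pair needs a link yet; constant paths serve as placeholders.
    linkage [] _ _ = inj₂ ((λ (x , _) → path 0 λ _ → x) , (λ ()) , λ _ _ ())
    linkage (e@(x , y) ∷ es) ends bound
      with linkage es (ends ∘ there) (≤-trans (s≤s (+-monoʳ-≤ (length Xs) (m≤n+m _ (suc D)))) bound)
    ... | inj₁ c = inj₁ c
    ... | inj₂ (P , joins , apart) with e ∈ₑ? es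
    -- A repeated pair keeps the link it has, as `Apart` is asked only of distinct pairs.
    ...   | yes e∈ = inj₂ (P , (joins ∘ old) , λ e₁ e₂ i j → apart e₁ e₂ (old i) (old j))
      where
      old : ∀ {e′} → e′ ∈ e ∷ es → e′ ∈ es
      old (here refl) = e∈
      old (there i)   = i
    ...   | no e∉ = extend (short-walk (proj₁ (ends (here refl))) (proj₂ (ends (here refl)))
                      (≤-trans (s≤s (≤-trans (List.length-filter other? used) used≤)) bound)
                      (λ i → proj₁ (proj₂ (∈-filter⁻ other? {xs = used} i)) refl)
                      (λ i → proj₂ (proj₂ (∈-filter⁻ other? {xs = used} i)) refl))
      where
      used : List V
      used = Xs ++ concatMap (vertices ∘ P) es
      other? : Decidable (λ v → v ≢ x × v ≢ y)
      other? v = ¬? (v Fin.≟ x) ×-dec ¬? (v Fin.≟ y)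

      used≤ : length used ≤ length Xs + length (e ∷ es) * suc D
      used≤ = begin
        length used                                               ≡⟨ List.length-++ Xs ⟩
        length Xs + length (concatMap (vertices ∘ P) es)          ≤⟨ +-monoʳ-≤ (length Xs) (concat≤ es joins) ⟩
        length Xs + length es * suc D                             ≤⟨ +-monoʳ-≤ (length Xs) (m≤n+m _ (suc D)) ⟩
        length Xs + length (e ∷ es) * suc D                       ∎
        where
        open ≤-Reasoning
        concat≤ : ∀ fs → (∀ {f} → f ∈ fs → Joins f (P f)) → length (concatMap (vertices ∘ P) fs) ≤ length fs * suc D
        concat≤ []       _ = z≤n
        concat≤ (f ∷ fs) j = subst (_≤ suc D + length fs * suc D) (sym (List.length-++ (vertices (P f))))
          (+-mono-≤ (≤-trans (≤-reflexive (List.length-applyUpTo (at (P f)) (suc (len (P f)))))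
                             (s≤s (proj₁ (proj₂ (proj₂ (j (here refl)))))))
                    (concat≤ fs (j ∘ there)))

      extend : C ⊎ ∃[ d ] (d ≤ D × Walk (_∉ filter other? used) d x y) → C ⊎ Linkage (e ∷ es)
      extend (inj₁ c) = inj₁ c
      extend (inj₂ (d , d≤ , w)) = inj₂ (P′ , joins′ , apart′)
        where
        p : Path
        p = path d (vertex w)
        P′ : V × V → Path
        P′ = P [ e ↦ p ]

        P′-new : P′ e ≡ p
        P′-new with e ≟ₑ e
        ... | yes _ = refl
        ... | no ne = ⊥-elim (ne refl)
        P′-old : ∀ {e′} → e′ ∈ es → P′ e′ ≡ P e′
        P′-old {e′} i with e′ ≟ₑ e
        ... | yes refl = ⊥-elim (e∉ i)
        ... | no _     = refl

        meets : ∀ i → vertex w i ∈ used → vertex w i ≡ x ⊎ vertex w i ≡ y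
        meets i u with vertex w i Fin.≟ x | vertex w i Fin.≟ y
        ... | yes a | _     = inj₁ a
        ... | _     | yes b = inj₂ b
        ... | no a  | no b  = ⊥-elim (vertex∈ w i (∈-filter⁺ other? u (a , b)))

        end∈ : ∀ {v} → v ≡ x ⊎ v ≡ y → v ∈ Xs
        end∈ (inj₁ refl) = proj₁ (ends (here refl))
        end∈ (inj₂ refl) = proj₂ (ends (here refl))

        interior : ∀ {i} → i ≤ d → vertex w i ≡ x ⊎ vertex w i ≡ y ⊎ vertex w i ∉ Xs
        interior {i} _ with vertex w i ∈? Xs
        ... | yes a = Sum.map₂ inj₁ (meets i (∈-++⁺ˡ a))
        ... | no ∉  = inj₂ (inj₂ ∉)

        joins′ : ∀ {e′} → e′ ∈ e ∷ es → Joins e′ (P′ e′)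
        joins′ (here refl) = subst (Joins e) (sym P′-new) (vertex-start w , vertex-end w , d≤ , vertex-adj w , interior)
        joins′ (there i)   = subst (Joins _) (sym (P′-old i)) (joins i)

        new-apart : ∀ {e′ i j} → e′ ∈ es → j ≤ len (P e′) → vertex w i ≡ at (P e′) j → vertex w i ∈ Xs
        new-apart {e′} {i} e∈ j≤ eq = end∈ (meets i (∈-++⁺ʳ Xs (∈-concatMap⁺ (vertices ∘ P)
          (Any.map (λ { refl → subst (_∈ vertices (P e′)) (sym eq) (at∈vertices (P e′) j≤) }) e∈))))

        apart′ : ∀ e₁ e₂ → e₁ ∈ e ∷ es → e₂ ∈ e ∷ es → e₁ ≢ e₂ → Apart (P′ e₁) (P′ e₂)
        apart′ _ _ (here refl) (here refl) ne = ⊥-elim (ne refl)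
        apart′ _ _ (here refl) (there j)   _  = subst₂ Apart (sym P′-new) (sym (P′-old j))
          λ _ j≤ eq → new-apart j j≤ eq
        apart′ _ _ (there i)   (here refl) _  = subst₂ Apart (sym (P′-old i)) (sym P′-new)
          λ i≤ _ eq → subst (_∈ Xs) (sym eq) (new-apart i i≤ (sym eq))
        apart′ _ _ (there i)   (there j)   ne = subst₂ Apart (sym (P′-old i)) (sym (P′-old j)) (apart _ _ i j ne)

-- From a homogeneous linkage to a biclique or a canonical graph

some-or-every : ∀ {A : Set} {P Q : A → Set} xs → (∀ {x} → x ∈ xs → P x ⊎ Q x) → ∃ P ⊎ (∀ {x} → x ∈ xs → Q x)
some-or-every []       _ = inj₂ λ ()
some-or-every (x ∷ xs) f with f (here refl) | some-or-every xs (f ∘ there)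
... | inj₁ p | _      = inj₁ (x , p)
... | _      | inj₁ e = inj₁ e
... | inj₂ q | inj₂ a = inj₂ λ { (here refl) → q ; (there i) → a i }

-- An edge between two links is recorded by the positions of its ends on them, each at most
-- `diam s`. Every pair of positions gives one relation on quadruples of hubs.
positions : ℕ → List (ℕ × ℕ)
positions s = cartesianProduct (upTo (suc (diam s))) (upTo (suc (diam s)))

module Hubs (G : Graph) (s : ℕ) (Xs : List (Fin (ord G))) where
  open Walks G
  open Diameter G s
  open Linkages G (diam s) Xs

  Crossing : (V × V → Path) → ℕ × ℕ → Vec V 4 → Set
  Crossing P (a , b) (x ∷ y ∷ z ∷ w ∷ []) =
    a ≤ len (P (x , y)) × b ≤ len (P (z , w)) × at (P (x , y)) a ~ at (P (z , w)) b

  crossing? : ∀ P i → Decidable (Crossing P i)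
  crossing? P (a , b) (x ∷ y ∷ z ∷ w ∷ []) =
    (a ≤? len (P (x , y))) ×-dec (b ≤? len (P (z , w))) ×-dec (at (P (x , y)) a ~? at (P (z , w)) b)

  module Mesh (links : Linkage (cartesianProduct Xs Xs)) (ys : List V) (ys⊑Xs : ys ⊑ Xs) (distinct : Unique ys) (x₀ : V) where
    open Nth x₀

    P : V × V → Path
    P = proj₁ links

    joins : ∀ {e} → e ∈ cartesianProduct Xs Xs → Joins e (P e)
    joins = proj₁ (proj₂ links)

    apart : ∀ e e′ → e ∈ cartesianProduct Xs Xs → e′ ∈ cartesianProduct Xs Xs → e ≢ e′ → Apart (P e) (P e′)
    apart = proj₂ (proj₂ links)

    N : ℕ
    N = length ys

    h : ℕ → V
    h = nth ys

    h∈Xs : ∀ {i} → i < N → h i ∈ Xs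
    h∈Xs i< = ⊑-lookup ys⊑Xs (nth∈ i<)

    h-inj : ∀ {i j} → i < N → j < N → h i ≡ h j → i ≡ j
    h-inj {i} {j} i< j< eq with <-cmp i j
    ... | tri< lt _ _ = ⊥-elim (nth-distinct distinct lt j< eq)
    ... | tri≈ _ e _  = e
    ... | tri> _ _ gt = ⊥-elim (nth-distinct distinct gt i< (sym eq))

    link : ℕ → ℕ → Path
    link i j = P (h i , h j)

    pair∈ : ∀ {i j} → i < N → j < N → (h i , h j) ∈ cartesianProduct Xs Xs
    pair∈ i< j< = ∈-cartesianProduct⁺ (h∈Xs i<) (h∈Xs j<)

    link-hubs : ∀ {i j c} → i < N → j < N → c ≤ len (link i j) → at (link i j) c ∈ Xs →
                at (link i j) c ≡ h i ⊎ at (link i j) c ≡ h j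
    link-hubs i< j< c≤ c∈ with proj₂ (proj₂ (proj₂ (proj₂ (joins (pair∈ i< j<))))) c≤
    ... | inj₁ eq        = inj₁ eq
    ... | inj₂ (inj₁ eq) = inj₂ eq
    ... | inj₂ (inj₂ ∉)  = ⊥-elim (∉ c∈)

    links-apart : ∀ {i j k l c d} → i < N → j < N → k < N → l < N → (i , j) ≢ (k , l) →
                  c ≤ len (link i j) → d ≤ len (link k l) → at (link i j) c ≡ at (link k l) d → at (link i j) c ∈ Xs
    links-apart i< j< k< l< ne = apart _ _ (pair∈ i< j<) (pair∈ k< l<)
      λ eq → ne (cong₂ _,_ (h-inj i< k< (cong proj₁ eq)) (h-inj j< l< (cong proj₂ eq)))

    -- Different links meet only in hubs, and a link contains no hubs but its ends.
    links-disjoint : ∀ {i j k l c d} → i < N → j < N → k < N → l < N → i ≢ k → i ≢ l → j ≢ k → j ≢ l →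
                     c ≤ len (link i j) → d ≤ len (link k l) → at (link i j) c ≢ at (link k l) d
    links-disjoint i< j< k< l< i≢k i≢l j≢k j≢l c≤ d≤ eq
      with c∈ ← links-apart i< j< k< l< (λ e → i≢k (cong proj₁ e)) c≤ d≤ eq
      with link-hubs i< j< c≤ c∈ | link-hubs k< l< d≤ (subst (_∈ Xs) eq c∈)
    ... | inj₁ a | inj₁ b = i≢k (h-inj i< k< (trans (sym a) (trans eq b)))
    ... | inj₁ a | inj₂ b = i≢l (h-inj i< l< (trans (sym a) (trans eq b)))
    ... | inj₂ a | inj₁ b = j≢k (h-inj j< k< (trans (sym a) (trans eq b)))
    ... | inj₂ a | inj₂ b = j≢l (h-inj j< l< (trans (sym a) (trans eq b)))

    -- The first `2 * q` hubs, in consecutive pairs, give the links carrying one side, the next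
    -- `2 * q` hubs those carrying the other. Every left pair precedes every right pair, so position
    -- `a` on a left link is adjacent to position `b` on a right one.
    module Biclique (q : ℕ) (4q≤N : 4 * q ≤ N) (a b : ℕ) (all-cross : Increasing 4 (Crossing P (a , b)) ys) where

      end : ∀ {i j} → i < q → j < q → suc (2 * q + 2 * j) < N
      end {i} {j} _ j< = ≤-trans (begin
        suc (suc (2 * q + 2 * j)) ≡⟨ regroup q j ⟩
        2 * q + 2 * suc j         ≤⟨ +-monoʳ-≤ (2 * q) (*-monoʳ-≤ 2 j<) ⟩
        2 * q + 2 * q             ≡⟨ regroup′ q ⟩
        4 * q                     ∎) 4q≤N
        where
        open ≤-Reasoning
        regroup : ∀ q j → suc (suc (2 * q + 2 * j)) ≡ 2 * q + 2 * suc j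
        regroup = solve-∀
        regroup′ : ∀ q → 2 * q + 2 * q ≡ 4 * q
        regroup′ = solve-∀

      before : ∀ {i} j → i < q → suc (2 * i) < 2 * q + 2 * j
      before {i} j i< = ≤-trans (≤-trans (≤-reflexive (regroup i)) (*-monoʳ-≤ 2 i<)) (m≤m+n (2 * q) (2 * j))
        where
        regroup : ∀ i → suc (suc (2 * i)) ≡ 2 * suc i
        regroup = solve-∀

      cross : ∀ {i j} → i < q → j < q →
              Crossing P (a , b) (h (2 * i) ∷ h (suc (2 * i)) ∷ h (2 * q + 2 * j) ∷ h (suc (2 * q + 2 * j)) ∷ [])
      cross {i} {j} i< j< = nth₄ ys _ all-cross (n<1+n (2 * i)) (before j i<) (n<1+n _) (end i< j<)

      left right : ℕ → V
      left  i = at (link (2 * i) (suc (2 * i))) a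
      right j = at (link (2 * q + 2 * j) (suc (2 * q + 2 * j))) b

      odd-end : ∀ {i} → i < q → suc (2 * i) < N
      odd-end {i} i< = <-trans (before i i<) (<-trans (n<1+n _) (end i< i<))

      left-distinct : ∀ {i j} → i < q → j < q → i ≢ j → left i ≢ left j
      left-distinct {i} {j} i< j< i≢j = links-disjoint
        (<-trans (n<1+n _) (odd-end i<)) (odd-end i<) (<-trans (n<1+n _) (odd-end j<)) (odd-end j<)
        (i≢j ∘ *-cancelˡ-≡ i j 2) (even≢odd i j) (even≢odd j i ∘ sym) (i≢j ∘ *-cancelˡ-≡ i j 2 ∘ suc-injective)
        (proj₁ (cross i< i<)) (proj₁ (cross j< j<))

      right-distinct : ∀ {i j} → i < q → j < q → i ≢ j → right i ≢ right j
      right-distinct {i} {j} i< j< i≢j = links-disjoint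
        (<-trans (n<1+n _) (end i< i<)) (end i< i<) (<-trans (n<1+n _) (end j< j<)) (end j< j<)
        (i≢j ∘ *-cancelˡ-≡ i j 2 ∘ +-cancelˡ-≡ (2 * q) _ _)
        (λ eq → even≢odd i j (+-cancelˡ-≡ (2 * q) _ _ (trans eq (sym (+-suc (2 * q) (2 * j))))))
        (λ eq → even≢odd j i (+-cancelˡ-≡ (2 * q) _ _ (trans (sym eq) (sym (+-suc (2 * q) (2 * i))))))
        (i≢j ∘ *-cancelˡ-≡ i j 2 ∘ +-cancelˡ-≡ (2 * q) _ _ ∘ suc-injective)
        (proj₁ (proj₂ (cross i< i<))) (proj₁ (proj₂ (cross j< j<)))

      fin-inj : ∀ {f : ℕ → V} → (∀ {i j} → i < q → j < q → i ≢ j → f i ≢ f j) → Injective _≡_ _≡_ (λ (i : Fin q) → f (toℕ i))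
      fin-inj distinct {i} {j} eq with toℕ i ≟ toℕ j
      ... | yes e = Fin.toℕ-injective e
      ... | no ne = ⊥-elim (distinct (Fin.toℕ<n i) (Fin.toℕ<n j) ne eq)

      biclique : ContainsBiclique q G
      biclique = left ∘ toℕ , right ∘ toℕ , fin-inj left-distinct , fin-inj right-distinct ,
        (λ i j eq → ~-irrefl eq (adjacent i j)) , adjacent
        where
        adjacent : ∀ (i j : Fin q) → left (toℕ i) ~ right (toℕ j)
        adjacent i j = proj₂ (proj₂ (cross (Fin.toℕ<n i) (Fin.toℕ<n j)))

    module Thick (none-cross : ∀ {i} → i ∈ positions s → Increasing 4 (¬_ ∘ Crossing P i) ys) (T : ℕ)
      (2D+2<T : 2 * diam s + 2 < T) (T+2<N : suc (suc T) < N) where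

      On : Path → V → Set
      On p v = ∃[ c ] (c < suc (len p) × v ≡ at p c)

      on? : ∀ p → Decidable (On p)
      on? p v = anyUpTo? (λ c → v Fin.≟ at p c) (suc (len p))

      -- A rough measure of the distance from `h 0`. A vertex, in particular a hub, can have several
      -- levels.
      Level : V → ℕ → Set
      Level v i = On (link i (1 + i)) v ⊎ On (link i (2 + i)) v

      A : V → Set
      A v = ∃[ i ] (i < suc T × Level v i)

      A? : Decidable A
      A? v = anyUpTo? (λ i → on? (link i (1 + i)) v ⊎-dec on? (link i (2 + i)) v) (suc T)

      in₀ : ∀ {i} → i ≤ suc (suc T) → i < N
      in₀ i≤ = ≤-<-trans i≤ T+2<N

      far-links : ∀ {i j k l u v} → i < j → j < k → k < l → l < N → On (link i j) u → On (link k l) v → ¬ u ~ v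
      far-links i<j j<k k<l l<N (c , c< , refl) (d , d< , refl) e =
        nth₄ ys _ (none-cross (∈-cartesianProduct⁺ (position i<N j<N c<) (position k<N l<N d<)))
          i<j j<k k<l l<N (s≤s⁻¹ c< , s≤s⁻¹ d< , e)
        where
        k<N = <-trans k<l l<N
        j<N = <-trans j<k k<N
        i<N = <-trans i<j j<N
        position : ∀ {i j c} → i < N → j < N → c < suc (len (link i j)) → c ∈ upTo (suc (diam s))
        position i< j< c< = ∈-upTo⁺ (≤-trans c< (s≤s (proj₁ (proj₂ (proj₂ (joins (pair∈ i< j<)))))))

      as-link : ∀ {v i} → Level v i → ∃[ d ] (0 < d × d ≤ 2 × On (link i (d + i)) v)
      as-link (inj₁ o) = 1 , z<s , s≤s z≤n , o
      as-link (inj₂ o) = 2 , z<s , ≤-refl , o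

      -- A link at level `i` ends at `h (2 + i)` at the latest. If `j` exceeded `2 + i`, it would
      -- wholly precede the link through `v`, and `far-links` would exclude the edge.
      level-step : ∀ {u v i j} → j < suc T → Level u i → Level v j → u ~ v → j ≤ 2 + i
      level-step {i = i} {j} j< lu lv e with d , 0<d , d≤ , ou ← as-link lu | d′ , 0<d′ , d′≤ , ov ← as-link lv =
        ≮⇒≥ λ lt → far-links (m<n+m i 0<d) (≤-<-trans (+-monoˡ-≤ i d≤) lt) (m<n+m j 0<d′)
          (in₀ (≤-trans (+-mono-≤ d′≤ (s≤s⁻¹ j<)) ≤-refl)) ou ov e

      level-walk : ∀ {d u v i} → Walk A d u v → Level u i → ∃[ j ] (j < suc T × Level v j × j ≤ 2 * d + i) ⊎ (d ≡ 0 × u ≡ v)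
      level-walk (nil _) lu = inj₂ (refl , refl)
      level-walk {suc d} {i = i} (cons _ e w) lu with j , j< , lv ← source∈ w with level-walk w lv
      ... | inj₂ (refl , refl) = inj₁ (j , j< , lv , level-step j< lu lv e)
      ... | inj₁ (k , k< , lk , k≤) = inj₁ (k , k< , lk , (begin
        k                   ≤⟨ k≤ ⟩
        2 * d + j           ≤⟨ +-monoʳ-≤ (2 * d) (level-step j< lu lv e) ⟩
        2 * d + (2 + i)     ≡⟨ regroup d i ⟩
        2 * suc d + i       ∎))
        where
        open ≤-Reasoning
        regroup : ∀ d i → 2 * d + (2 + i) ≡ 2 * suc d + i
        regroup = solve-∀

      module _ {B : V → Set} where
        link-reach : ∀ {i j} → i < N → j < N → (∀ {v} → On (link i j) v → B v) → Reach B (h i) (h j)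
        link-reach {i} {j} i< j< ⊆B with start , finish , _ , adjacent , _ ← joins (pair∈ i< j<) =
          len (link i j) , subst₂ (Walk B (len (link i j))) start finish
            (subpath (at (link i j)) 0 (len (link i j)) (λ c _ c≤ → ⊆B (c , s≤s c≤ , refl)) adjacent)

      hub-on : ∀ {i j k} → i < N → j < N → k < N → On (link i j) (h k) → k ≡ i ⊎ k ≡ j
      hub-on i< j< k< (c , c< , eq) =
        Sum.map (λ a → h-inj k< i< (trans eq a)) (λ b → h-inj k< j< (trans eq b))
          (link-hubs i< j< (s≤s⁻¹ c<) (subst (_∈ Xs) eq (h∈Xs k<)))

      link₁∈ : ∀ {i v} → i < suc T → On (link i (1 + i)) v → A v
      link₁∈ i< o = _ , i< , inj₁ o

      link₂∈ : ∀ {i v} → i < suc T → On (link i (2 + i)) v → A v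
      link₂∈ i< o = _ , i< , inj₂ o

      connected : ∀ {i} → i ≤ T → Reach A (h 0) (h i)
      connected {zero}  _  with start , _ ← joins (pair∈ {0} {1} (in₀ z≤n) (in₀ (s≤s z≤n))) =
        reach-refl (0 , z<s , inj₁ (0 , z<s , sym start))
      connected {suc i} i< = reach-trans (connected (<⇒≤ i<))
        (link-reach (in₀ (≤-trans (<⇒≤ i<) (m≤n+m T 2))) (in₀ (≤-trans i< (m≤n+m T 2))) (link₁∈ (m≤n⇒m≤1+n i<)))

      module _ (z : V) (z≢h0 : z ≢ h 0) where

        clear : ∀ {i j v} → (On (link i j) v → A v) → ¬ On (link i j) z → On (link i j) v → (A ∖ z) v
        clear ⊆A z∉ o = ⊆A o , λ { refl → z∉ o }

        -- A vertex z that is not a hub lies on at most one link, so one of the two sides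
        -- of the triangle h i, h (1 + i), h (2 + i) survives the deletion of z.
        next : ∀ {i} → i < T → h i ≢ z → h (1 + i) ≢ z → Reach (A ∖ z) (h i) (h (1 + i))
        next {i} i<T hi≢z hi+1≢z with on? (link i (1 + i)) z
        ... | no z∉ = link-reach i< 1+i< (clear {i} {1 + i} (link₁∈ (m≤n⇒m≤1+n i<T)) z∉)
          where
          i<   = in₀ {i} (≤-trans (<⇒≤ i<T) (m≤n+m T 2))
          1+i< = in₀ {1 + i} (≤-trans i<T (m≤n+m T 2))
        ... | yes (c , c< , eq) = reach-trans
            (link-reach i< 2+i< (clear {i} {2 + i} (link₂∈ (m≤n⇒m≤1+n i<T))
              (elsewhere i< 2+i< λ e → 1+n≢n (sym (cong proj₂ e)))))
            (reach-sym (link-reach 1+i< 2+i< (clear {1 + i} {2 + i} (link₁∈ (s≤s i<T))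
              (elsewhere 1+i< 2+i< λ e → 1+n≢n (sym (cong proj₁ e))))))
          where
          i<   = in₀ {i} (≤-trans (<⇒≤ i<T) (m≤n+m T 2))
          1+i< = in₀ {1 + i} (≤-trans i<T (m≤n+m T 2))
          2+i< = in₀ {2 + i} (≤-trans (s≤s i<T) (n≤1+n (suc T)))
          z∉Xs : z ∉ Xs
          z∉Xs z∈ with link-hubs i< 1+i< (s≤s⁻¹ c<) (subst (_∈ Xs) eq z∈)
          ... | inj₁ a = hi≢z (sym (trans eq a))
          ... | inj₂ b = hi+1≢z (sym (trans eq b))
          elsewhere : ∀ {k l} → k < N → l < N → (i , 1 + i) ≢ (k , l) → ¬ On (link k l) z
          elsewhere k< l< ne (d , d< , eq′) =
            z∉Xs (subst (_∈ Xs) (sym eq) (links-apart i< 1+i< k< l< ne (s≤s⁻¹ c<) (s≤s⁻¹ d<) (trans (sym eq) eq′)))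

        -- A link contains no third hub, so the link from `h i` to `h (2 + i)` passes around `z`.
        skip : ∀ {i} → i < T → h (1 + i) ≡ z → Reach (A ∖ z) (h i) (h (2 + i))
        skip {i} i<T refl = link-reach i< 2+i< (clear {i} {2 + i} (link₂∈ (m≤n⇒m≤1+n i<T)) λ o →
            case hub-on i< 2+i< 1+i< o of λ { (inj₁ e) → 1+n≢n e ; (inj₂ e) → 1+n≢n (sym e) })
          where
          i<   = in₀ {i} (≤-trans (<⇒≤ i<T) (m≤n+m T 2))
          1+i< = in₀ {1 + i} (≤-trans i<T (m≤n+m T 2))
          2+i< = in₀ {2 + i} (≤-trans (s≤s i<T) (n≤1+n (suc T)))

        -- If the previous hub is `z`, the walk jumps over it from the hub before, which differs
        -- from `z` because hubs are distinct; otherwise `next` continues from the previous hub.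
        bridge : ∀ {i} → 2 + i ≤ T → h (2 + i) ≢ z → (h (1 + i) ≢ z → Reach (A ∖ z) (h 0) (h (1 + i))) →
                 (h i ≢ z → Reach (A ∖ z) (h 0) (h i)) → Reach (A ∖ z) (h 0) (h (2 + i))
        bridge {i} i≤ ne via₁ via₀ with h (1 + i) Fin.≟ z
        ... | no ne′ = reach-trans (via₁ ne′) (next i≤ ne′ ne)
        ... | yes eq = reach-trans (via₀ λ e → 1+n≢n (sym (h-inj (in₀ {i} (≤-trans (<⇒≤ (<⇒≤ i≤)) (m≤n+m T 2)))
                                     (in₀ {1 + i} (≤-trans (<⇒≤ i≤) (m≤n+m T 2))) (trans e (sym eq)))))
                         (skip (<⇒≤ i≤) eq)

        robust : ∀ i → i ≤ T → h i ≢ z → Reach (A ∖ z) (h 0) (h i)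
        robust zero          _  _  = reach-refl (target∈ (connected z≤n) , z≢h0 ∘ sym)
        robust (suc zero)    1≤ ne = next 1≤ (z≢h0 ∘ sym) ne
        robust (suc (suc i)) i≤ ne = bridge i≤ ne (robust (suc i) (<⇒≤ i≤)) (robust i (<⇒≤ (<⇒≤ i≤)))

      -- No vertex separates `h 0` from `h T` in `A`. Yet a walk of at most `diam s` edges from
      -- level 0 ends at a vertex having a level at most `2 * diam s`, while every level of `h T` is
      -- at least `T - 2`. So `diameter` must return a canonical graph.
      canonical : ContainsCanonical s G
      canonical with diameter A? (connected ≤-refl) (λ z z≢0 z≢T → robust z z≢0 T ≤-refl (z≢T ∘ sym))
      ... | inj₁ c = c
      ... | inj₂ (d , d≤ , w) = ⊥-elim (too-short (level-walk w start))
        where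
        start : Level (h 0) 0
        start = inj₁ (0 , z<s , sym (proj₁ (joins (pair∈ {0} {1} (in₀ z≤n) (in₀ (s≤s z≤n))))))
        T<N : T < N
        T<N = in₀ (m≤n+m T 2)
        too-short : ¬ (∃[ j ] (j < suc T × Level (h T) j × j ≤ 2 * d + 0) ⊎ (d ≡ 0 × h 0 ≡ h T))
        too-short (inj₂ (_ , eq)) = case h-inj (in₀ z≤n) T<N eq of λ { refl → case 2D+2<T of λ () }
        too-short (inj₁ (j , j< , lv , j≤)) with e , _ , e≤ , o ← as-link lv =
          <-irrefl refl (begin-strict
            T                ≤⟨ T≤ ⟩
            2 + j            ≤⟨ +-monoʳ-≤ 2 j≤ ⟩
            2 + (2 * d + 0)  ≡⟨ cong (2 +_) (+-identityʳ (2 * d)) ⟩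
            2 + 2 * d        ≤⟨ +-monoʳ-≤ 2 (*-monoʳ-≤ 2 d≤) ⟩
            2 + 2 * diam s   ≡⟨ +-comm 2 (2 * diam s) ⟩
            2 * diam s + 2   <⟨ 2D+2<T ⟩
            T                ∎)
          where
          open ≤-Reasoning
          T≤ : T ≤ 2 + j
          T≤ with hub-on (in₀ (≤-trans (s≤s⁻¹ j<) (m≤n+m T 2))) (in₀ (+-mono-≤ e≤ (s≤s⁻¹ j<))) T<N o
          ... | inj₁ refl = m≤n+m T 2
          ... | inj₂ eq = ≤-trans (≤-reflexive eq) (+-monoˡ-≤ j e≤)

-- Choice of the constants and assembly of the proof

module Parameters (s q : ℕ) where

  -- k exceeds the number of vertices on M² links, and θ bounds the diam s-th layer around a vertex.
  t m M k θ : ℕ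
  t = suc (2 * diam s + 2)
  m = 3 + t + 4 * q
  M = multiRamseyNumber 4 m (length (positions s))
  k = suc (M + M * M * suc (diam s))
  θ = suc (suc k ^ diam s * M)

  module _ (G : Graph) where
    open Walks G

    Unavoidable : Set
    Unavoidable = ContainsCanonical s G ⊎ ContainsBiclique q G

    module _ (Xs : List V) (unique : Unique Xs) (∣Xs∣≡M : length Xs ≡ M) where
      open Hubs G s Xs
      open Linkages G (diam s) Xs

      linked-hubs : Linkage (cartesianProduct Xs Xs) → Unavoidable
      linked-hubs links@(P , _) =
        mesh (multi-ramsey 4 m {Crossing P} (crossing? P) (positions s) Xs (≤-reflexive (sym ∣Xs∣≡M)))
        where
        mesh : ∃[ ys ] (ys ⊑ Xs × m ≤ length ys × (∀ {i} → i ∈ positions s → Homogeneous 4 (Crossing P i) ys)) → Unavoidable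
        -- `m` is positive, so there is a hub `y` to serve as the default value of `nth`.
        mesh ([] , _ , () , _)
        mesh (ys@(y ∷ _) , ys⊑Xs , m≤ , homogeneous) with some-or-every (positions s) homogeneous
        -- `m` is a sum so that either outcome has enough hubs: `4 * q` for the biclique, `3 + t`
        -- for the long subgraph.
        ... | inj₁ ((a , b) , all-cross) = inj₂ (Biclique.biclique q (≤-trans (m≤n+m (4 * q) (3 + t)) m≤) a b all-cross)
          where open Mesh links ys ys⊑Xs (unique-⊑ ys⊑Xs unique) y
        ... | inj₂ none-cross = inj₁ (Thick.canonical none-cross t ≤-refl (≤-trans (m≤m+n (3 + t) (4 * q)) m≤))
          where open Mesh links ys ys⊑Xs (unique-⊑ ys⊑Xs unique) y

    module _ (W : List V) (haven : ∀ Z → length Z ≤ θ → ∃[ v ] Majority.Big G W Z v) where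
      open Majority G W
      open Haven θ haven
      open Attachment s k

      hubs : List V
      hubs = take M attached

      open Linkages G (diam s) hubs

      hub-linkage : M ≤ length attached → ContainsCanonical s G ⊎ Linkage (cartesianProduct hubs hubs)
      hub-linkage M≤ = linkage (λ x∈ y∈ → short-walk (attached∈ x∈) (attached∈ y∈)) (cartesianProduct hubs hubs)
          (∈-cartesianProduct⁻ hubs hubs) (s≤s (≤-reflexive size))
        where
        attached∈ : ∀ {x} → x ∈ hubs → x ∈ attached
        attached∈ = ⊑-lookup (take-⊆ M attached)
        ∣hubs∣ : length hubs ≡ M
        ∣hubs∣ = trans (List.length-take M attached) (m≤n⇒m⊓n≡m M≤)
        size : length hubs + length (cartesianProduct hubs hubs) * suc (diam s) ≡ M + M * M * suc (diam s)
        size = cong₂ (λ a b → a + b * suc (diam s)) ∣hubs∣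
                 (trans (length-cartesianProduct hubs hubs) (cong₂ _*_ ∣hubs∣ ∣hubs∣))

      haven-unavoidable : Unavoidable
      haven-unavoidable with suc (length attached) ≤? M
      -- By `few` the layer bound is at most `suc k ^ diam s * M`, which is below `θ`.
      ... | yes few = inj₁ (few-attached (≤-trans (*-monoʳ-≤ (suc k ^ diam s) few) (n≤1+n _)))
      ... | no many with hub-linkage (≮⇒≥ many)
      ...   | inj₁ canonical = inj₁ canonical
      ...   | inj₂ links = linked-hubs hubs
        (Unique.take⁺ M (Unique.filter⁺ (¬? ∘ separable?) (Unique.allFin⁺ (ord G))))
        (trans (List.length-take M attached) (m≤n⇒m⊓n≡m (≮⇒≥ many))) links

    -- If no balanced separator of size at most `θ` exists, every `Z` of that size leaves a big
    -- component, up to a double negation that decidability removes; this is the haven needed above.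
    separate : ∀ W → Unavoidable ⊎ ∃[ Z ] TreeBuilding.Balanced G θ W Z
    separate W with anyList? (λ Z → ¬? (Fin.any? (Majority.big? G W Z))) θ
    ... | yes (Z , Z≤ , none) = inj₂ (Z , Z≤ , λ v v∉ → ≮⇒≥ λ lt → none (v , v∉ , lt))
    ... | no haven = inj₁ (haven-unavoidable W λ Z Z≤ →
      decidable-stable (Fin.any? (Majority.big? G W Z)) λ none → haven (Z , Z≤ , none))

    unavoidable : TreewidthAtLeast (suc (4 * θ)) G → Unavoidable
    unavoidable = TreeBuilding.Grow.fail-or-decompose G θ (s≤s z≤n) (λ W _ → separate W)

theorem4 : ∀ (s q : ℕ) → ∃[ X ] (∀ (G : Graph) → TreewidthAtLeast X G →
    ContainsCanonical s G ⊎ ContainsBiclique q G)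
theorem4 s q = suc (4 * θ) , unavoidable
  where open Parameters s q
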